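{- For $u,v,w\in S_n$ the following are equivalent: (1) $w$ lies in the tilted Bruhat interval $[u,v]$; (2) for all $\mathbf{a}\in[n]^n$ with $u\le_{\mathbf{a}}v$, we have $u\le_{\mathbf{a}}w\le_{\mathbf{a}}v$; (3) there exists $\mathbf{a}\in[n]^n$ with $u\le_{\mathbf{a}}w\le_{\mathbf{a}}v$; (4) for all $\mathbf{a}\in[n]^n$ with $u\lesssim_{\mathbf{a}}v$, we have $u\lesssim_{\mathbf{a}}w\lesssim_{\mathbf{a}}v$; (5) there exists $\mathbf{a}\in[n]^n$ with $u\lesssim_{\mathbf{a}}w\lesssim_{\mathbf{a}}v$.
   Context: Permutations are in one-line notation $w=w_1\cdots w_n$, $w[k]:=\{w_1,\dots,w_k\}$; $wt_{ij}$ swaps the entries of $w$ in positions $i<j$; $\ell(w)$ is the number of inversions. Quantum Bruhat graph $\Gamma_n$: directed graph on $S_n$ with an edge $w\to wt_{ij}$ ($i<j$) whenever $\ell(wt_{ij})=\ell(w)+1$ or $\ell(wt_{ij})=\ell(w)+1-2(j-i)$. Let $\ell(x,y)$ be the length of a shortest directed path from $x$ to $y$ in $\Gamma_n$. The tilted Bruhat interval is $[u,v]:=\{w\in S_n:\ell(u,w)+\ell(w,v)=\ell(u,v)\}$. Cyclic interval $[a,b)_c$: $\{a,\dots,b-1\}$ if $a\le b$, $\{a,\dots,n\}\cup\{1,\dots,b-1\}$ if $a>b$. For $r\in[n]$, $<_r$ is the order $r<_r r+1<_r\cdots<_r n<_r 1<_r\cdots<_r r-1$ on $[n]$; for $k$-subsets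 $A=\{a_1<_r\cdots<_r a_k\}$, $B=\{b_1<_r\cdots<_r b_k\}$, $A\le_r B$ means $a_i\le_r b_i$ for all $i$. For $\mathbf{a}=(a_1,\dots,a_n)\in[n]^n$: $u\le_{\mathbf{a}}v$ iff $u[k]\le_{a_k}v[k]$ for all $k\in[n]$; $u\sim_{\mathbf{a}}v$ iff $|u[k]\cap[a_k,a_{k+1})_c|=|v[k]\cap[a_k,a_{k+1})_c|$ for all $k\in[n-1]$; $u\lesssim_{\mathbf{a}}v$ iff $u\le_{\mathbf{a}}v$ and $u\sim_{\mathbf{a}}v$. -}

module Defs where

open import Data.Nat using (ℕ; zero; suc; _+_; _*_; _∸_; _≤_; _<_)
open import Data.Fin as F using (Fin; toℕ; fromℕ<)
open import Data.Fin.Properties using (_≟_)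
open import Data.Vec as V using (Vec; lookup; _[_]≔_; toList)
open import Data.List as L using (List; length; filter; allFin; cartesianProduct; take; _++_)
open import Data.List.Relation.Binary.Pointwise using (Pointwise)
import Data.List.Membership.DecPropositional as DecMem
open import Data.Product using (Σ; ∃; _×_; _,_; proj₁; proj₂)
open import Data.Sum using (_⊎_)
open import Relation.Binary.PropositionalEquality using (_≡_)
open import Relation.Nullary using (Dec)
open import Relation.Nullary.Decidable using (_×-dec_; _⊎-dec_)

-- CONVENTION: 0-indexed.  [n] = {1..n} is modelled by Fin n = {0..n-1}
-- (value/position x+1 in the paper is x here).  A permutation of [n] in
-- one-line notation is a vector w = (w_1,...,w_n) of entries in Fin n that is
-- injective (hence bijective).

Word : ℕ → Set
Word n = Vec (Fin n) n

IsPerm : ∀ {n} → Word n → Set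
IsPerm {n} w = ∀ (i j : Fin n) → lookup w i ≡ lookup w j → i ≡ j

swapPos : ∀ {n} → Word n → Fin n → Fin n → Word n
swapPos w i j = (w [ i ]≔ lookup w j) [ j ]≔ lookup w i

inv : ∀ {n} → Word n → ℕ
inv {n} w = length (filter (λ p → F._<?_ (proj₁ p) (proj₂ p) ×-dec F._<?_ (lookup w (proj₂ p)) (lookup w (proj₁ p)))
                           (cartesianProduct (allFin n) (allFin n)))

-- edges of the quantum Bruhat graph Γ_n:  w → w t_ij  (i < j) with
-- ℓ(w t_ij) = ℓ(w) + 1  or  ℓ(w t_ij) = ℓ(w) + 1 - 2(j - i)
QBEdge : ∀ {n} → Word n → Word n → Set
QBEdge {n} w w' = Σ (Fin n) λ i → Σ (Fin n) λ j →
  (i F.< j) × (w' ≡ swapPos w i j) ×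
  ((inv w' ≡ suc (inv w)) ⊎ (inv w' + 2 * (toℕ j ∸ toℕ i) ≡ suc (inv w)))

data QBPath {n} : Word n → Word n → ℕ → Set where
  here  : ∀ {x} → QBPath x x 0
  there : ∀ {x y z k} → QBEdge x y → QBPath y z k → QBPath x z (suc k)

QBDist : ∀ {n} → Word n → Word n → ℕ → Set
QBDist x y d = QBPath x y d × (∀ k → QBPath x y k → d ≤ k)

InTilted : ∀ {n} → Word n → Word n → Word n → Set
InTilted u v w = Σ ℕ λ d₁ → Σ ℕ λ d₂ → Σ ℕ λ d →
  QBDist u w d₁ × QBDist w v d₂ × QBDist u v d × (d₁ + d₂ ≡ d)

-- the order <_r on [n]:  r < r+1 < ... < n < 1 < ... < r-1   (non-strict version)
_≤[_]_ : ∀ {n} → Fin n → Fin n → Fin n → Set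
x ≤[ r ] y = ((r F.≤ x) × (r F.≤ y) × (x F.≤ y))
           ⊎ ((x F.< r) × (y F.< r) × (x F.≤ y))
           ⊎ ((r F.≤ x) × (y F.< r))

cycList : ∀ {n} → Fin n → List (Fin n)
cycList {n} r = filter (λ x → r F.≤? x) (allFin n) ++ filter (λ x → x F.<? r) (allFin n)

prefix : ∀ {n} → ℕ → Word n → List (Fin n)
prefix k w = take k (toList w)

sortedBy : ∀ {n} → Fin n → List (Fin n) → List (Fin n)
sortedBy {n} r A = filter (λ x → x ∈? A) (cycList r)
  where open DecMem (_≟_ {n}) using (_∈?_)

_⊑[_]_ : ∀ {n} → List (Fin n) → Fin n → List (Fin n) → Set
A ⊑[ r ] B = Pointwise (λ a b → a ≤[ r ] b) (sortedBy r A) (sortedBy r B)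

-- u ≤_a v  iff  u[k] ≤_{a_k} v[k] for all k ∈ [n]   (k ↦ index k-1 here)
_≤ₐ[_]_ : ∀ {n} → Word n → Word n → Word n → Set
_≤ₐ[_]_ {n} u a v = ∀ (k : Fin n) → prefix (suc (toℕ k)) u ⊑[ lookup a k ] prefix (suc (toℕ k)) v

InCyc : ∀ {n} → Fin n → Fin n → Fin n → Set
InCyc a b x = ((a F.≤ b) × (a F.≤ x) × (x F.< b)) ⊎ ((b F.< a) × ((a F.≤ x) ⊎ (x F.< b)))

inCyc? : ∀ {n} (a b x : Fin n) → Dec (InCyc a b x)
inCyc? a b x = ((a F.≤? b) ×-dec (a F.≤? x) ×-dec (x F.<? b)) ⊎-dec ((b F.<? a) ×-dec ((a F.≤? x) ⊎-dec (x F.<? b)))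

-- |A ∩ [a,b)_c|  (A given by a duplicate-free list)
countCyc : ∀ {n} → Fin n → Fin n → List (Fin n) → ℕ
countCyc a b A = length (filter (inCyc? a b) A)

-- u ∼_a v  iff  |u[k] ∩ [a_k,a_{k+1})_c| = |v[k] ∩ [a_k,a_{k+1})_c| for k ∈ [n-1]
-- (paper's k ∈ [n-1] is written suc k with k : ℕ, suc (suc k) ≤ n)
_∼ₐ[_]_ : ∀ {n} → Word n → Word n → Word n → Set
_∼ₐ[_]_ {n} u a v = ∀ (k : ℕ) (p : suc k < n) →
  countCyc (lookup a (fromℕ< {k} (Data.Nat.Properties.<-trans (Data.Nat.Properties.n<1+n k) p))) (lookup a (fromℕ< p)) (prefix (suc k) u)
  ≡ countCyc (lookup a (fromℕ< {k} (Data.Nat.Properties.<-trans (Data.Nat.Properties.n<1+n k) p))) (lookup a (fromℕ< p)) (prefix (suc k) v)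
  where import Data.Nat.Properties

_≲ₐ[_]_ : ∀ {n} → Word n → Word n → Word n → Set
u ≲ₐ[ a ] v = (u ≤ₐ[ a ] v) × (u ∼ₐ[ a ] v)

{-# OPTIONS --safe #-}
-- For the prefixes of length k of u and v let f_k(s) = |u[k] ∩ [1,s)| − |v[k] ∩ [1,s)|.  Then
-- u[k] ≤_r v[k] says that r minimises f_k, and a_k, a_{k+1} meet the ∼ condition at k when f_k takes
-- the same value at both.
--
-- For any a put Φ_a(w) = ℓ(w) + 2 Σ_k |w[k] ∩ [1,a_k)|.  An edge of Γ_n raises Φ_a by at most 1, so
-- ℓ(u,v) ≥ Φ_a(v) − Φ_a(u).  If u ≤_a v this is an equality: let i be the first position where u and v
-- differ and j > i the first one with u_j in the cyclic interval (u_i,v_i]; then u → u t_ij is an edge,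
-- raises Φ_a by 1 and keeps u t_ij ≤_a v.
--
-- Hence u ≤_a w ≤_a v gives ℓ(u,w) + ℓ(w,v) = ℓ(u,v).  Conversely, if w lies in [u,v] and u ≤_a v, the
-- bounds for (u,w) and (w,v) are attained at a, and varying a single coordinate of a shows u ≤_a w ≤_a v.
module Submission where

open import Defs
open import Data.Bool using (true; false; if_then_else_)
open import Data.Fin as F using (Fin; toℕ; fromℕ<; zero; suc)
open import Data.Fin.Permutation.Components using (transpose; transpose-inverse)
open import Data.Fin.Properties using (_≟_; toℕ-injective; toℕ<n; toℕ-fromℕ<; any?; injective⇒≤; punchOut-injective)
open import Data.List as L using (List; []; _∷_; length; filter; allFin; cartesianProduct; take; _++_; map)
open import Data.List.Membership.Propositional using (_∈_)
open import Data.List.Membership.Propositional.Properties using (∈-allFin; ∈-filter⁺; ∈-filter⁻; ∈-++⁺ˡ; ∈-++⁺ʳ)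
open import Data.List.Membership.Propositional.Properties.WithK using (unique∧set⇒bag)
import Data.List.Membership.DecPropositional as DecMembership
open import Data.List.Properties using (length-++; length-take; filter-++; filter-some; filter-none; filter-accept)
open import Data.List.Relation.Binary.BagAndSetEquality using (∼bag⇒↭)
open import Data.List.Relation.Binary.Permutation.Propositional using (_↭_)
open import Data.List.Relation.Binary.Permutation.Propositional.Properties using (filter-↭; ↭-length)
open import Data.List.Relation.Binary.Pointwise using (Pointwise; []; _∷_)
open import Data.List.Relation.Unary.All as All using (All; []; _∷_)
open import Data.List.Relation.Unary.All.Properties using (all-filter)
open import Data.List.Relation.Unary.AllPairs as AllPairs using (AllPairs; []; _∷_)
import Data.List.Relation.Unary.AllPairs.Properties as AllPairs
open import Data.List.Relation.Unary.Any using (here)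
open import Data.List.Relation.Unary.Unique.Propositional using (Unique)
import Data.List.Relation.Unary.Unique.Propositional.Properties as Unique
open import Data.Nat using (ℕ; zero; suc; _+_; _*_; _∸_; _⊓_; _≤_; _<_; z≤n; s≤s; s≤s⁻¹; _≤?_; _<?_)
open import Data.Nat.Properties hiding (_≟_; _≤?_; _<?_)
open import Algebra.Properties.CommutativeMonoid.Sum +-0-commutativeMonoid using (sum; ∑-distrib-+; sum-cong-≗)
open import Data.Nat.Tactic.RingSolver using (solve-∀)
open import Data.Product using (Σ; ∃; _×_; _,_; proj₁; proj₂)
open import Data.Sum using (_⊎_; inj₁; inj₂)
open import Data.Vec as V using (Vec; lookup; []; _∷_; toList)
open import Data.Vec.Properties using (lookup∘update; lookup∘update′; lookup∘tabulate; tabulate∘lookup; tabulate-cong; length-toList; ≡-dec)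
open import Function using (_∘_; id)
open import Function.Bundles using (_⇔_; mk⇔; Equivalence)
open import Relation.Binary.Definitions using (tri<; tri≈; tri>)
open import Relation.Binary.PropositionalEquality using (_≡_; _≢_; refl; sym; trans; cong; cong₂; subst; subst₂; ≢-sym; module ≡-Reasoning)
open import Relation.Nullary using (Dec; yes; no; does; ¬_; contradiction)
open import Relation.Nullary.Decidable using (_×-dec_; _⊎-dec_; ¬?; decidable-stable)
open import Relation.Unary using (Decidable)

-- Why one altered coordinate suffices at the end: with f_k formed from u and w, Φ_b(w) - Φ_b(u) =
-- ℓ(w) - ℓ(u) - 2 Σ_k f_k(b_k), and every b_k enters only its own summand. Hence a vector that
-- maximises this difference minimises each f_k separately, and attaining the upper bound d says
-- precisely that the difference is maximal.
--
-- The universal conditions (2) and (4) would be vacuous for a pair u, v without a suitable a. So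
-- some a with u ≲_a v has to be produced for every pair; it comes from choosing each a_k to
-- minimise f_{k-1} and f_k at once, which makes a_k and a_{k+1} two minimisers of the same f_k.
--
-- The functions f_k take negative values. To remain in ℕ, f_k(r) ≤ f_k(s) is written with crossed
-- terms, u-count at r plus v-count at s against u-count at s plus v-count at r.

-- Indicators, and inequalities without subtraction

-- The equation says x - y = a - b. To derive `x ≤ y` from several inequalities, take for `a` and
-- `b` the sums of their left and right sides; what remains is a ring identity, usually called
-- `balance`.
≤-shift : ∀ {x y a b} → a ≤ b → x + b ≡ y + a → x ≤ y
≤-shift {x} {y} {a} {b} a≤b eq = +-cancelʳ-≤ b x y (subst (_≤ y + b) (sym eq) (+-monoʳ-≤ y a≤b))

when : ∀ {P : Set} → Dec P → ℕ → ℕ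
when d x = if does d then x else 0

ind : ∀ {P : Set} → Dec P → ℕ
ind d = when d 1

module _ {P : Set} where

  when-yes : (d : Dec P) {x : ℕ} → P → when d x ≡ x
  when-yes (yes _) _ = refl
  when-yes (no ¬p) p = contradiction p ¬p

  when-no : (d : Dec P) {x : ℕ} → ¬ P → when d x ≡ 0
  when-no (yes p) ¬p = contradiction p ¬p
  when-no (no _)  _  = refl

  when-+ : (d : Dec P) (x y : ℕ) → when d (x + y) ≡ when d x + when d y
  when-+ (yes _) x y = refl
  when-+ (no _)  x y = refl

  when-mono : (d : Dec P) {x y : ℕ} → (P → x ≤ y) → when d x ≤ when d y
  when-mono (yes p) x≤y = x≤y p
  when-mono (no _)  _   = z≤n

  ind≤1 : (d : Dec P) → ind d ≤ 1
  ind≤1 (yes _) = ≤-refl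
  ind≤1 (no _)  = z≤n

ind-mono : ∀ {P Q : Set} (d : Dec P) (e : Dec Q) → (P → Q) → ind d ≤ ind e
ind-mono (no _)  e       f = z≤n
ind-mono (yes p) (yes q) f = ≤-refl
ind-mono (yes p) (no ¬q) f = contradiction (f p) ¬q

ind-cong : ∀ {P Q : Set} (d : Dec P) (e : Dec Q) → (P → Q) → (Q → P) → ind d ≡ ind e
ind-cong d e f g = ≤-antisym (ind-mono d e f) (ind-mono e d g)

ind-× : ∀ {P Q : Set} (d : Dec P) (e : Dec Q) → ind (d ×-dec e) ≡ when d (ind e)
ind-× (yes _) (yes _) = refl
ind-× (yes _) (no _)  = refl
ind-× (no _)  _       = refl

-- Finite sums

sum-mono : ∀ {n} {f g : Fin n → ℕ} → (∀ p → f p ≤ g p) → sum f ≤ sum g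
sum-mono {zero}  f≤g = z≤n
sum-mono {suc n} f≤g = +-mono-≤ (f≤g zero) (sum-mono (f≤g ∘ suc))

sum-mono-< : ∀ {n} {f g : Fin n → ℕ} i → (∀ p → f p ≤ g p) → f i < g i → sum f < sum g
sum-mono-< zero    f≤g fi<gi = +-mono-<-≤ fi<gi (sum-mono (f≤g ∘ suc))
sum-mono-< (suc i) f≤g fi<gi = +-mono-≤-< (f≤g zero) (sum-mono-< i (f≤g ∘ suc) fi<gi)

sum-0 : ∀ n → sum {n} (λ _ → 0) ≡ 0
sum-0 zero    = refl
sum-0 (suc n) = sum-0 n

sum-≡0 : ∀ {n} {f : Fin n → ℕ} → (∀ p → f p ≡ 0) → sum f ≡ 0
sum-≡0 {n} f≡0 = trans (sum-cong-≗ f≡0) (sum-0 n)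

sum-differ₁ : ∀ {n} {f g : Fin n → ℕ} i → (∀ p → p ≢ i → f p ≡ g p) → sum f + g i ≡ sum g + f i
sum-differ₁ {f = f} {g} zero f≡g = begin
  f zero + sum (f ∘ suc) + g zero ≡⟨ cong (λ s → f zero + s + g zero) (sum-cong-≗ λ p → f≡g (suc p) λ ()) ⟩
  f zero + sum (g ∘ suc) + g zero ≡⟨ swapOuter (f zero) (sum (g ∘ suc)) (g zero) ⟩
  g zero + sum (g ∘ suc) + f zero ∎
  where
  open ≡-Reasoning
  swapOuter : ∀ a b c → a + b + c ≡ c + b + a
  swapOuter = solve-∀
sum-differ₁ {f = f} {g} (suc i) f≡g = begin
  f zero + sum (f ∘ suc) + g (suc i)   ≡⟨ +-assoc (f zero) _ _ ⟩
  f zero + (sum (f ∘ suc) + g (suc i)) ≡⟨ cong₂ _+_ (f≡g zero λ ()) (sum-differ₁ i λ p p≢i → f≡g (suc p) λ { refl → p≢i refl }) ⟩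
  g zero + (sum (g ∘ suc) + f (suc i)) ≡⟨ +-assoc (g zero) _ _ ⟨
  g zero + sum (g ∘ suc) + f (suc i)   ∎
  where open ≡-Reasoning

sum-differ₂ : ∀ {n} {f g : Fin n → ℕ} i j → i ≢ j → (∀ p → p ≢ i → p ≢ j → f p ≡ g p) →
              sum f + (g i + g j) ≡ sum g + (f i + f j)
sum-differ₂ {n} {f} {g} i j i≢j f≡g = begin
  sum f + (g i + g j) ≡⟨ +-assoc (sum f) (g i) (g j) ⟨
  sum f + g i + g j   ≡⟨ cong (λ x → sum f + x + g j) (h-i) ⟨
  sum f + h i + g j   ≡⟨ cong (_+ g j) (sum-differ₁ {f = f} {h} i (λ p p≢i → sym (h-≢ p p≢i))) ⟩
  sum h + f i + g j   ≡⟨ swapLast (sum h) (f i) (g j) ⟩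
  sum h + g j + f i   ≡⟨ cong (_+ f i) (sum-differ₁ {f = h} {g} j h≡g) ⟩
  sum g + h j + f i   ≡⟨ cong (λ x → sum g + x + f i) (h-≢ j (≢-sym i≢j)) ⟩
  sum g + f j + f i   ≡⟨ swapLast′ (sum g) (f j) (f i) ⟩
  sum g + (f i + f j) ∎
  where
  open ≡-Reasoning
  swapLast : ∀ a b c → a + b + c ≡ a + c + b
  swapLast = solve-∀
  swapLast′ : ∀ a b c → a + b + c ≡ a + (c + b)
  swapLast′ = solve-∀
  -- `h` interpolates: it differs from `f` at most at `i`, and from `g` at most at `j`.
  h : Fin n → ℕ
  h p = if does (p ≟ i) then g p else f p
  h-i : h i ≡ g i
  h-i with i ≟ i
  ... | yes _  = refl
  ... | no i≢i = contradiction refl i≢i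
  h-≢ : ∀ p → p ≢ i → h p ≡ f p
  h-≢ p p≢i with p ≟ i
  ... | yes p≡i = contradiction p≡i p≢i
  ... | no _    = refl
  h≡g : ∀ p → p ≢ j → h p ≡ g p
  h≡g p p≢j with p ≟ i
  ... | yes refl = refl
  ... | no p≢i   = f≡g p p≢i p≢j

-- Masking the two swapped positions keeps every partial sum a sum over all of `Fin n`, so the
-- pointwise lemmas still apply.
off : ∀ {n} → Fin n → Fin n → (Fin n → ℕ) → Fin n → ℕ
off i j f p = if does (p ≟ i) then 0 else if does (p ≟ j) then 0 else f p

off-≢ : ∀ {n} (i j : Fin n) f {p} → p ≢ i → p ≢ j → off i j f p ≡ f p
off-≢ i j f {p} p≢i p≢j with p ≟ i | p ≟ j
... | yes p≡i | _       = contradiction p≡i p≢i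
... | no _    | yes p≡j = contradiction p≡j p≢j
... | no _    | no _    = refl

off-cong : ∀ {n} (i j : Fin n) {f g : Fin n → ℕ} → (∀ p → p ≢ i → p ≢ j → f p ≡ g p) → ∀ p → off i j f p ≡ off i j g p
off-cong i j f≡g p with p ≟ i | p ≟ j
... | yes _  | _      = refl
... | no _   | yes _  = refl
... | no p≢i | no p≢j = f≡g p p≢i p≢j

off-i : ∀ {n} (i j : Fin n) f → off i j f i ≡ 0
off-i i j f with i ≟ i
... | yes _  = refl
... | no i≢i = contradiction refl i≢i

off-j : ∀ {n} (i j : Fin n) f → off i j f j ≡ 0
off-j i j f with j ≟ i | j ≟ j
... | yes _ | _      = refl
... | no _  | yes _  = refl
... | no _  | no j≢j = contradiction refl j≢j

off-+ : ∀ {n} (i j : Fin n) f g p → off i j (λ q → f q + g q) p ≡ off i j f p + off i j g p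
off-+ i j f g p with p ≟ i | p ≟ j
... | yes _ | _     = refl
... | no _  | yes _ = refl
... | no _  | no _  = refl

sum-off : ∀ {n} (i j : Fin n) → i ≢ j → ∀ f → sum f ≡ sum (off i j f) + (f i + f j)
sum-off i j i≢j f = begin
  sum f                                 ≡⟨ +-identityʳ (sum f) ⟨
  sum f + 0                             ≡⟨ cong₂ (λ x y → sum f + (x + y)) (off-i i j f) (off-j i j f) ⟨
  sum f + (off i j f i + off i j f j)   ≡⟨ sum-differ₂ i j i≢j (λ p p≢i p≢j → sym (off-≢ i j f p≢i p≢j)) ⟩
  sum (off i j f) + (f i + f j)         ∎
  where open ≡-Reasoning

-- Pairs of positions are sorted by how many members lie in {i, j}: none, one or two. A row and a
-- column are joined at the same `p` because only their joint contribution changes in a simple way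
-- under a swap.
sum-sum-off : ∀ {n} (i j : Fin n) → i ≢ j → ∀ (g : Fin n → Fin n → ℕ) →
  sum (λ p → sum (g p)) ≡
    sum (off i j (λ p → sum (off i j (g p))))
    + (sum (off i j (λ p → (g p i + g p j) + (g i p + g j p)))
    + ((g i i + g i j) + (g j i + g j j)))
sum-sum-off i j i≢j g = begin
  sum (λ p → sum (g p)) ≡⟨ sum-off i j i≢j (λ p → sum (g p)) ⟩
  sum (off i j (λ p → sum (g p))) + (sum (g i) + sum (g j))
    ≡⟨ cong₂ _+_ (trans (sum-cong-≗ (off-cong i j λ p _ _ → sum-off i j i≢j (g p)))
         (trans (sum-cong-≗ (off-+ i j rest cols)) (∑-distrib-+ (off i j rest) (off i j cols))))
         (cong₂ _+_ (sum-off i j i≢j (g i)) (sum-off i j i≢j (g j))) ⟩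
  sum (off i j rest) + sum (off i j cols) + ((sum (off i j (g i)) + (g i i + g i j)) + (sum (off i j (g j)) + (g j i + g j j)))
    ≡⟨ regroup (sum (off i j rest)) (sum (off i j cols)) (sum (off i j (g i))) (g i i + g i j) (sum (off i j (g j))) (g j i + g j j) ⟩
  sum (off i j rest) + (sum (off i j cols) + (sum (off i j (g i)) + sum (off i j (g j))) + ((g i i + g i j) + (g j i + g j j)))
    ≡⟨ cong (λ s → sum (off i j rest) + (s + ((g i i + g i j) + (g j i + g j j)))) merge ⟨
  sum (off i j rest) + (sum (off i j (λ p → cols p + rows p)) + ((g i i + g i j) + (g j i + g j j))) ∎
  where
  open ≡-Reasoning
  rest cols rows : Fin _ → ℕ
  rest p = sum (off i j (g p))
  cols p = g p i + g p j
  rows p = g i p + g j p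
  regroup : ∀ a b c d e f → a + b + ((c + d) + (e + f)) ≡ a + (b + (c + e) + (d + f))
  regroup = solve-∀
  merge : sum (off i j (λ p → cols p + rows p)) ≡ sum (off i j cols) + (sum (off i j (g i)) + sum (off i j (g j)))
  merge = trans (trans (sum-cong-≗ (off-+ i j cols rows)) (∑-distrib-+ (off i j cols) (off i j rows)))
    (cong (sum (off i j cols) +_) (trans (sum-cong-≗ (off-+ i j (g i) (g j))) (∑-distrib-+ (off i j (g i)) (off i j (g j)))))

sum-below : ∀ {n} m → m ≤ n → sum {n} (λ k → ind (toℕ k <? m)) ≡ m
sum-below {n}     zero    _         = sum-≡0 {n} λ k → when-no (toℕ k <? 0) {1} λ ()
sum-below {suc n} (suc m) (s≤s m≤n) = cong suc (trans (sum-cong-≗ {n} λ k → ind-cong (suc (toℕ k) <? suc m) (toℕ k <? m) s≤s⁻¹ s≤s) (sum-below m m≤n))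

sum-interval : ∀ {n} lo hi → lo ≤ hi → hi ≤ n → sum {n} (λ k → ind (lo ≤? toℕ k ×-dec toℕ k <? hi)) + lo ≡ hi
sum-interval {n} lo hi lo≤hi hi≤n = begin
  sum within + lo         ≡⟨ cong (sum within +_) (sum-below lo (≤-trans lo≤hi hi≤n)) ⟨
  sum within + sum (λ (k : Fin n) → ind (toℕ k <? lo)) ≡⟨ ∑-distrib-+ within (λ k → ind (toℕ k <? lo)) ⟨
  sum (λ (k : Fin n) → within k + ind (toℕ k <? lo)) ≡⟨ sum-cong-≗ split ⟩
  sum (λ (k : Fin n) → ind (toℕ k <? hi)) ≡⟨ sum-below hi hi≤n ⟩
  hi ∎
  where
  open ≡-Reasoning
  within : Fin n → ℕ
  within k = ind (lo ≤? toℕ k ×-dec toℕ k <? hi)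
  split : ∀ k → within k + ind (toℕ k <? lo) ≡ ind (toℕ k <? hi)
  split k with <-≤-connex (toℕ k) lo
  ... | inj₁ k<lo = trans (cong₂ _+_ (when-no (lo ≤? toℕ k ×-dec toℕ k <? hi) λ (lo≤k , _) → <⇒≱ k<lo lo≤k) (when-yes (toℕ k <? lo) k<lo))
                          (sym (when-yes (toℕ k <? hi) (<-≤-trans k<lo lo≤hi)))
  ... | inj₂ lo≤k = trans (cong₂ _+_ (ind-cong (lo ≤? toℕ k ×-dec toℕ k <? hi) (toℕ k <? hi) proj₂ (lo≤k ,_)) (when-no (toℕ k <? lo) (≤⇒≯ lo≤k)))
                          (+-identityʳ _)

-- Lengths of filtered lists as sums of indicators

length-filter-tabulate : ∀ {A : Set} {P : A → Set} (P? : Decidable P) {n} (f : Fin n → A) →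
                         length (filter P? (L.tabulate f)) ≡ sum (λ p → ind (P? (f p)))
length-filter-tabulate P? {zero}  f = refl
length-filter-tabulate P? {suc n} f with does (P? (f zero))
... | true  = cong suc (length-filter-tabulate P? (f ∘ suc))
... | false = length-filter-tabulate P? (f ∘ suc)

length-filter-map : ∀ {A B : Set} {P : B → Set} (P? : Decidable P) (f : A → B) xs →
                    length (filter P? (map f xs)) ≡ length (filter (P? ∘ f) xs)
length-filter-map P? f []       = refl
length-filter-map P? f (x ∷ xs) with does (P? (f x))
... | true  = cong suc (length-filter-map P? f xs)
... | false = length-filter-map P? f xs

length-filter-cartesianProduct : ∀ {A B : Set} {P : A × B → Set} (P? : Decidable P) {m n} (f : Fin m → A) (g : Fin n → B) →
  length (filter P? (cartesianProduct (L.tabulate f) (L.tabulate g))) ≡ sum (λ p → sum (λ q → ind (P? (f p , g q))))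
length-filter-cartesianProduct P? {zero}  f g = refl
length-filter-cartesianProduct P? {suc m} f g = begin
  length (filter P? (map (f zero ,_) (L.tabulate g) ++ cartesianProduct (L.tabulate (f ∘ suc)) (L.tabulate g)))
    ≡⟨ cong length (filter-++ P? (map (f zero ,_) (L.tabulate g)) _) ⟩
  length (filter P? (map (f zero ,_) (L.tabulate g)) ++ filter P? (cartesianProduct (L.tabulate (f ∘ suc)) (L.tabulate g)))
    ≡⟨ length-++ (filter P? (map (f zero ,_) (L.tabulate g))) ⟩
  length (filter P? (map (f zero ,_) (L.tabulate g))) + length (filter P? (cartesianProduct (L.tabulate (f ∘ suc)) (L.tabulate g)))
    ≡⟨ cong₂ _+_ (trans (length-filter-map P? (f zero ,_) (L.tabulate g)) (length-filter-tabulate (P? ∘ (f zero ,_)) g))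
                 (length-filter-cartesianProduct P? (f ∘ suc) g) ⟩
  sum (λ q → ind (P? (f zero , g q))) + sum (λ p → sum (λ q → ind (P? (f (suc p) , g q)))) ∎
  where open ≡-Reasoning

length-filter-take : ∀ {A : Set} {P : A → Set} (P? : Decidable P) {n} (xs : Vec A n) k →
                     length (filter P? (take k (toList xs))) ≡ sum (λ p → when (toℕ p <? k) (ind (P? (lookup xs p))))
length-filter-take P? {n} xs       zero    = sym (sum-≡0 {n} λ p → when-no (toℕ p <? 0) {ind (P? (lookup xs p))} λ ())
length-filter-take P? []       (suc k) = refl
length-filter-take P? {suc n} (x ∷ xs) (suc k) with does (P? x)
... | true  = cong suc (trans (length-filter-take P? xs k) (sum-cong-≗ {n} λ p → refl))
... | false = trans (length-filter-take P? xs k) (sum-cong-≗ {n} λ p → refl)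

-- Words and transpositions

lookup-ext : ∀ {n} {x y : Word n} → (∀ p → lookup x p ≡ lookup y p) → x ≡ y
lookup-ext {x = x} {y} eq = trans (sym (tabulate∘lookup x)) (trans (tabulate-cong eq) (tabulate∘lookup y))

module _ {n} (w : Word n) {i j : Fin n} (i≢j : i ≢ j) where

  lookup-swapˡ : lookup (swapPos w i j) i ≡ lookup w j
  lookup-swapˡ = trans (lookup∘update′ i≢j (w V.[ i ]≔ lookup w j) (lookup w i)) (lookup∘update i w (lookup w j))

  lookup-swapʳ : lookup (swapPos w i j) j ≡ lookup w i
  lookup-swapʳ = lookup∘update j (w V.[ i ]≔ lookup w j) (lookup w i)

  lookup-swap-≢ : ∀ {p} → p ≢ i → p ≢ j → lookup (swapPos w i j) p ≡ lookup w p
  lookup-swap-≢ p≢i p≢j = trans (lookup∘update′ p≢j (w V.[ i ]≔ lookup w j) (lookup w i)) (lookup∘update′ p≢i w (lookup w j))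

  lookup-swap : ∀ p → lookup (swapPos w i j) p ≡ lookup w (transpose i j p)
  lookup-swap p with p ≟ i
  ... | yes refl = lookup-swapˡ
  ... | no p≢i with p ≟ j
  ...   | yes refl = lookup-swapʳ
  ...   | no p≢j   = lookup-swap-≢ p≢i p≢j

  swapPos-perm : IsPerm w → IsPerm (swapPos w i j)
  swapPos-perm w-perm p q eq = begin
    p                                 ≡⟨ transpose-inverse j i ⟨
    transpose j i (transpose i j p)   ≡⟨ cong (transpose j i) (w-perm _ _ (trans (sym (lookup-swap p)) (trans eq (lookup-swap q)))) ⟩
    transpose j i (transpose i j q)   ≡⟨ transpose-inverse j i ⟩
    q                                 ∎
    where open ≡-Reasoning

swapPos-involutive : ∀ {n} (w : Word n) {i j : Fin n} → i ≢ j → swapPos (swapPos w i j) i j ≡ w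
swapPos-involutive w {i} {j} i≢j = lookup-ext go
  where
  go : ∀ p → lookup (swapPos (swapPos w i j) i j) p ≡ lookup w p
  go p with p ≟ i
  ... | yes refl = trans (lookup-swapˡ (swapPos w i j) i≢j) (lookup-swapʳ w i≢j)
  ... | no p≢i with p ≟ j
  ...   | yes refl = trans (lookup-swapʳ (swapPos w i j) i≢j) (lookup-swapˡ w i≢j)
  ...   | no p≢j   = trans (lookup-swap-≢ (swapPos w i j) i≢j p≢i p≢j) (lookup-swap-≢ w i≢j p≢i p≢j)

<⇒≢ᶠ : ∀ {n} {i j : Fin n} → i F.< j → i ≢ j
<⇒≢ᶠ i<j refl = <-irrefl refl i<j

lookup-≢ : ∀ {n} (w : Word n) → IsPerm w → ∀ {p q} → p ≢ q → toℕ (lookup w p) ≢ toℕ (lookup w q)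
lookup-≢ w w-perm p≢q eq = p≢q (w-perm _ _ (toℕ-injective eq))

-- Inversions

crossing : ∀ {n} → Word n → Fin n → Fin n → ℕ
crossing w p q = when (p F.<? q) (ind (lookup w q F.<? lookup w p))

inv-sum : ∀ {n} (w : Word n) → inv w ≡ sum (λ p → sum (crossing w p))
inv-sum {n} w = trans
  (length-filter-cartesianProduct (λ p → proj₁ p F.<? proj₂ p ×-dec lookup w (proj₂ p) F.<? lookup w (proj₁ p)) {n} {n} id id)
  (sum-cong-≗ λ p → sum-cong-≗ λ q → ind-× (p F.<? q) (lookup w q F.<? lookup w p))

-- Marks the positions that make the swap of a non-inverted pair cost more than one inversion. None
-- of them gives an upward edge; all j - i - 1 of them, counted in the word after the swap, give a
-- quantum edge.
between : ∀ {n} → Word n → Fin n → Fin n → Fin n → ℕ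
between w i j q = ind ((i F.<? q ×-dec q F.<? j) ×-dec (lookup w i F.<? lookup w q ×-dec lookup w q F.<? lookup w j))

-- Here a, b are the values at `i`, `j` and x is the value at a position between them. The left side
-- counts its inversions with the two positions after the swap, and the first two terms on the right
-- count those before.
ind-split : ∀ {a b x} → a < b → x ≢ a → x ≢ b →
  ind (a <? x) + ind (x <? b) ≡ ind (b <? x) + ind (x <? a) + 2 * ind (a <? x ×-dec x <? b)
ind-split {a} {b} {x} a<b x≢a x≢b with <-cmp x a
... | tri≈ _ x≡a _ = contradiction x≡a x≢a
... | tri< x<a _ a≮x
  rewrite when-no (a <? x) {1} a≮x | when-yes (x <? b) {1} (<-trans x<a a<b)
        | when-no (b <? x) {1} (<⇒≯ (<-trans x<a a<b)) | when-yes (x <? a) {1} x<a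
        | when-no (a <? x ×-dec x <? b) {1} (a≮x ∘ proj₁) = refl
... | tri> x≮a _ a<x with <-cmp x b
...   | tri≈ _ x≡b _ = contradiction x≡b x≢b
...   | tri< x<b _ b≮x
  rewrite when-yes (a <? x) {1} a<x | when-yes (x <? b) {1} x<b
        | when-no (b <? x) {1} b≮x | when-no (x <? a) {1} x≮a
        | when-yes (a <? x ×-dec x <? b) {1} (a<x , x<b) = refl
...   | tri> x≮b _ b<x
  rewrite when-yes (a <? x) {1} a<x | when-no (x <? b) {1} x≮b
        | when-yes (b <? x) {1} b<x | when-no (x <? a) {1} x≮a
        | when-no (a <? x ×-dec x <? b) {1} (x≮b ∘ proj₂) = refl

module _ {n} {w : Word n} (w-perm : IsPerm w) {i j : Fin n} (i<j : i F.< j) (wi<wj : lookup w i F.< lookup w j) where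
  private
    w′ = swapPos w i j
    i≢j = <⇒≢ᶠ i<j

    cross : Word n → Fin n → ℕ
    cross x p = (crossing x p i + crossing x p j) + (crossing x i p + crossing x j p)

    -- A position left or right of both `i` and `j` sees the two swapped values on the same side, so
    -- its two contributions only change places. For a position between them the change is given by
    -- `ind-split`.
    cross-swap : ∀ p → p ≢ i → p ≢ j → cross w′ p ≡ cross w p + 2 * between w i j p
    cross-swap p p≢i p≢j
      rewrite lookup-swapˡ w i≢j | lookup-swapʳ w i≢j | lookup-swap-≢ w i≢j p≢i p≢j
      with <-cmp (toℕ p) (toℕ i) | <-cmp (toℕ p) (toℕ j)
    ... | tri≈ _ p≡i _ | _ = contradiction (toℕ-injective p≡i) p≢i
    ... | _ | tri≈ _ p≡j _ = contradiction (toℕ-injective p≡j) p≢j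
    ... | tri< p<i _ i≮p | tri> _ _ j<p = contradiction (<-trans i<j j<p) i≮p
    ... | tri< p<i _ i≮p | tri< p<j _ j≮p
      rewrite when-yes (p F.<? i) {ind (lookup w j F.<? lookup w p)} p<i | when-yes (p F.<? i) {ind (lookup w i F.<? lookup w p)} p<i
            | when-yes (p F.<? j) {ind (lookup w j F.<? lookup w p)} p<j | when-yes (p F.<? j) {ind (lookup w i F.<? lookup w p)} p<j
            | when-no (i F.<? p) {ind (lookup w p F.<? lookup w j)} i≮p | when-no (i F.<? p) {ind (lookup w p F.<? lookup w i)} i≮p
            | when-no (j F.<? p) {ind (lookup w p F.<? lookup w j)} j≮p | when-no (j F.<? p) {ind (lookup w p F.<? lookup w i)} j≮p
            | when-no ((i F.<? p ×-dec p F.<? j) ×-dec (lookup w i F.<? lookup w p ×-dec lookup w p F.<? lookup w j)) {1} (i≮p ∘ proj₁ ∘ proj₁)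
            = outer (ind (lookup w j F.<? lookup w p)) (ind (lookup w i F.<? lookup w p))
      where
      outer : ∀ a b → (a + b) + 0 ≡ (b + a) + 0 + 0
      outer = solve-∀
    ... | tri> p≮i _ i<p | tri> p≮j _ j<p
      rewrite when-no (p F.<? i) {ind (lookup w j F.<? lookup w p)} p≮i | when-no (p F.<? i) {ind (lookup w i F.<? lookup w p)} p≮i
            | when-no (p F.<? j) {ind (lookup w j F.<? lookup w p)} p≮j | when-no (p F.<? j) {ind (lookup w i F.<? lookup w p)} p≮j
            | when-yes (i F.<? p) {ind (lookup w p F.<? lookup w j)} i<p | when-yes (i F.<? p) {ind (lookup w p F.<? lookup w i)} i<p
            | when-yes (j F.<? p) {ind (lookup w p F.<? lookup w j)} j<p | when-yes (j F.<? p) {ind (lookup w p F.<? lookup w i)} j<p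
            | when-no ((i F.<? p ×-dec p F.<? j) ×-dec (lookup w i F.<? lookup w p ×-dec lookup w p F.<? lookup w j)) {1} (p≮j ∘ proj₂ ∘ proj₁)
            = outer (ind (lookup w p F.<? lookup w j)) (ind (lookup w p F.<? lookup w i))
      where
      outer : ∀ a b → a + b ≡ b + a + 0
      outer = solve-∀
    ... | tri> p≮i _ i<p | tri< p<j _ j≮p
      rewrite when-no (p F.<? i) {ind (lookup w j F.<? lookup w p)} p≮i | when-no (p F.<? i) {ind (lookup w i F.<? lookup w p)} p≮i
            | when-yes (p F.<? j) {ind (lookup w j F.<? lookup w p)} p<j | when-yes (p F.<? j) {ind (lookup w i F.<? lookup w p)} p<j
            | when-yes (i F.<? p) {ind (lookup w p F.<? lookup w j)} i<p | when-yes (i F.<? p) {ind (lookup w p F.<? lookup w i)} i<p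
            | when-no (j F.<? p) {ind (lookup w p F.<? lookup w j)} j≮p | when-no (j F.<? p) {ind (lookup w p F.<? lookup w i)} j≮p
            | ind-× (i F.<? p ×-dec p F.<? j) (lookup w i F.<? lookup w p ×-dec lookup w p F.<? lookup w j)
            | when-yes (i F.<? p ×-dec p F.<? j) {ind (lookup w i F.<? lookup w p ×-dec lookup w p F.<? lookup w j)} (i<p , p<j)
            = begin
      ind (lookup w i F.<? lookup w p) + (ind (lookup w p F.<? lookup w j) + 0) ≡⟨ cong (ind (lookup w i F.<? lookup w p) +_) (+-identityʳ _) ⟩
      ind (lookup w i F.<? lookup w p) + ind (lookup w p F.<? lookup w j) ≡⟨ ind-split wi<wj (lookup-≢ w w-perm p≢i) (lookup-≢ w w-perm p≢j) ⟩
      ind (lookup w j F.<? lookup w p) + ind (lookup w p F.<? lookup w i) + 2 * b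
        ≡⟨ cong (λ s → ind (lookup w j F.<? lookup w p) + s + 2 * b) (+-identityʳ _) ⟨
      ind (lookup w j F.<? lookup w p) + (ind (lookup w p F.<? lookup w i) + 0) + 2 * b ∎
      where
      open ≡-Reasoning
      b = ind (lookup w i F.<? lookup w p ×-dec lookup w p F.<? lookup w j)

    corners : Word n → ℕ
    corners x = (crossing x i i + crossing x i j) + (crossing x j i + crossing x j j)

    corners-inner : ∀ x → corners x ≡ ind (lookup x j F.<? lookup x i)
    corners-inner x
      rewrite when-no (i F.<? i) {ind (lookup x i F.<? lookup x i)} (<-irrefl refl)
            | when-yes (i F.<? j) {ind (lookup x j F.<? lookup x i)} i<j
            | when-no (j F.<? i) {ind (lookup x i F.<? lookup x j)} (<⇒≯ i<j)
            | when-no (j F.<? j) {ind (lookup x j F.<? lookup x j)} (<-irrefl refl) = +-identityʳ _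

    inv-off : ∀ x → inv x ≡ sum (off i j (λ p → sum (off i j (crossing x p)))) + (sum (off i j (cross x)) + corners x)
    inv-off x = trans (inv-sum x) (sum-sum-off i j i≢j (crossing x))

    off-between : ∀ p → off i j (between w i j) p ≡ between w i j p
    off-between p with p ≟ i | p ≟ j
    ... | yes refl | _ = sym (when-no ((i F.<? i ×-dec i F.<? j) ×-dec (lookup w i F.<? lookup w i ×-dec lookup w i F.<? lookup w j)) (<-irrefl refl ∘ proj₁ ∘ proj₁))
    ... | no _ | yes refl = sym (when-no ((i F.<? j ×-dec j F.<? j) ×-dec (lookup w i F.<? lookup w j ×-dec lookup w j F.<? lookup w j)) (<-irrefl refl ∘ proj₂ ∘ proj₁))
    ... | no _ | no _ = refl

    sum-cross-swap : sum (off i j (cross w′)) ≡ sum (off i j (cross w)) + 2 * sum (between w i j)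
    sum-cross-swap = begin
      sum (off i j (cross w′)) ≡⟨ sum-cong-≗ (λ p → trans (off-cong i j cross-swap p) (trans (off-+ i j (cross w) (λ q → 2 * between w i j q) p)
                                     (cong (off i j (cross w) p +_) (off-double p)))) ⟩
      sum (λ p → off i j (cross w) p + (between w i j p + between w i j p)) ≡⟨ ∑-distrib-+ (off i j (cross w)) _ ⟩
      sum (off i j (cross w)) + sum (λ p → between w i j p + between w i j p)
        ≡⟨ cong (sum (off i j (cross w)) +_) (trans (∑-distrib-+ (between w i j) (between w i j)) (double (sum (between w i j)))) ⟩
      sum (off i j (cross w)) + 2 * sum (between w i j) ∎
      where
      open ≡-Reasoning
      double : ∀ a → a + a ≡ 2 * a
      double = solve-∀
      off-double : ∀ p → off i j (λ q → 2 * between w i j q) p ≡ between w i j p + between w i j p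
      off-double p = trans (off-cong i j {g = λ q → between w i j q + between w i j q} (λ q _ _ → sym (double (between w i j q))) p)
        (trans (off-+ i j (between w i j) (between w i j) p) (cong₂ _+_ (off-between p) (off-between p)))

    off-crossing-swap : sum (off i j (λ p → sum (off i j (crossing w′ p)))) ≡ sum (off i j (λ p → sum (off i j (crossing w p))))
    off-crossing-swap = sum-cong-≗ (off-cong i j λ p p≢i p≢j → sum-cong-≗ (off-cong i j λ q q≢i q≢j →
      cong₂ (λ a b → when (p F.<? q) (ind (a F.<? b))) (lookup-swap-≢ w i≢j q≢i q≢j) (lookup-swap-≢ w i≢j p≢i p≢j)))

  inv-swap : inv (swapPos w i j) ≡ suc (inv w) + 2 * sum (between w i j)
  inv-swap = begin
    inv w′ ≡⟨ inv-off w′ ⟩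
    sum (off i j (λ p → sum (off i j (crossing w′ p)))) + (sum (off i j (cross w′)) + corners w′)
      ≡⟨ cong₂ _+_ off-crossing-swap (cong₂ _+_ sum-cross-swap corners-w′) ⟩
    inner + (sum (off i j (cross w)) + 2 * sum (between w i j) + 1)
      ≡⟨ regroup inner (sum (off i j (cross w))) (sum (between w i j)) ⟩
    suc (inner + (sum (off i j (cross w)) + 0)) + 2 * sum (between w i j)
      ≡⟨ cong (λ c → suc (inner + (sum (off i j (cross w)) + c)) + 2 * sum (between w i j)) corners-w ⟨
    suc (inner + (sum (off i j (cross w)) + corners w)) + 2 * sum (between w i j)
      ≡⟨ cong (λ s → suc s + 2 * sum (between w i j)) (inv-off w) ⟨
    suc (inv w) + 2 * sum (between w i j) ∎
    where
    open ≡-Reasoning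
    inner = sum (off i j (λ p → sum (off i j (crossing w p))))
    regroup : ∀ a b c → a + (b + 2 * c + 1) ≡ suc (a + (b + 0)) + 2 * c
    regroup = solve-∀
    corners-w : corners w ≡ 0
    corners-w = trans (corners-inner w) (when-no (lookup w j F.<? lookup w i) (<⇒≯ wi<wj))
    corners-w′ : corners w′ ≡ 1
    corners-w′ = trans (corners-inner w′) (when-yes (lookup w′ j F.<? lookup w′ i)
      (subst₂ F._<_ (sym (lookup-swapʳ w i≢j)) (sym (lookup-swapˡ w i≢j)) wi<wj))

-- Cyclic intervals of ℕ

-- The natural-number version of `InCyc`. Ends of the form γ + 1 occur, and these may equal n, which
-- is not in `Fin n`. Equal ends give the empty interval.
Cyc : ℕ → ℕ → ℕ → Set
Cyc a b x = (a ≤ b × a ≤ x × x < b) ⊎ (b < a × (a ≤ x ⊎ x < b))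

cyc? : ∀ a b x → Dec (Cyc a b x)
cyc? a b x = (a ≤? b ×-dec a ≤? x ×-dec x <? b) ⊎-dec (b <? a ×-dec (a ≤? x ⊎-dec x <? b))

-- The indicator of [a, b)_c is [x < b] - [x < a], plus 1 when the interval wraps around. Cyclic
-- counts thereby become differences of counts over initial segments.
cyc-count : ∀ a b x → ind (cyc? a b x) + ind (x <? a) ≡ ind (x <? b) + ind (b <? a)
cyc-count a b x with <-≤-connex b a | <-≤-connex x a | <-≤-connex x b
... | inj₁ b<a | inj₁ x<a | inj₁ x<b
  rewrite when-yes (cyc? a b x) {1} (inj₂ (b<a , inj₂ x<b)) | when-yes (x <? a) {1} x<a
        | when-yes (x <? b) {1} x<b | when-yes (b <? a) {1} b<a = refl
... | inj₁ b<a | inj₁ x<a | inj₂ b≤x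
  rewrite when-no (cyc? a b x) {1} (λ { (inj₁ (_ , a≤x , _)) → <⇒≱ x<a a≤x ; (inj₂ (_ , inj₁ a≤x)) → <⇒≱ x<a a≤x ; (inj₂ (_ , inj₂ x<b)) → <⇒≱ x<b b≤x })
        | when-yes (x <? a) {1} x<a | when-no (x <? b) {1} (≤⇒≯ b≤x) | when-yes (b <? a) {1} b<a = refl
... | inj₁ b<a | inj₂ a≤x | inj₁ x<b = contradiction x<b (≤⇒≯ (≤-trans (<⇒≤ b<a) a≤x))
... | inj₁ b<a | inj₂ a≤x | inj₂ b≤x
  rewrite when-yes (cyc? a b x) {1} (inj₂ (b<a , inj₁ a≤x)) | when-no (x <? a) {1} (≤⇒≯ a≤x)
        | when-no (x <? b) {1} (≤⇒≯ b≤x) | when-yes (b <? a) {1} b<a = refl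
... | inj₂ a≤b | inj₁ x<a | inj₁ x<b
  rewrite when-no (cyc? a b x) {1} (λ { (inj₁ (_ , a≤x , _)) → <⇒≱ x<a a≤x ; (inj₂ (b<a , _)) → <⇒≱ b<a a≤b })
        | when-yes (x <? a) {1} x<a | when-yes (x <? b) {1} x<b | when-no (b <? a) {1} (≤⇒≯ a≤b) = refl
... | inj₂ a≤b | inj₁ x<a | inj₂ b≤x = contradiction (<-≤-trans x<a a≤b) (≤⇒≯ b≤x)
... | inj₂ a≤b | inj₂ a≤x | inj₁ x<b
  rewrite when-yes (cyc? a b x) {1} (inj₁ (a≤b , a≤x , x<b)) | when-no (x <? a) {1} (≤⇒≯ a≤x)
        | when-yes (x <? b) {1} x<b | when-no (b <? a) {1} (≤⇒≯ a≤b) = refl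
... | inj₂ a≤b | inj₂ a≤x | inj₂ b≤x
  rewrite when-no (cyc? a b x) {1} (λ { (inj₁ (_ , _ , x<b)) → <⇒≱ x<b b≤x ; (inj₂ (b<a , _)) → <⇒≱ b<a a≤b })
        | when-no (x <? a) {1} (≤⇒≯ a≤x) | when-no (x <? b) {1} (≤⇒≯ b≤x) | when-no (b <? a) {1} (≤⇒≯ a≤b) = refl

-- The cyclic interval (α , β].
Arc : ℕ → ℕ → ℕ → Set
Arc α β = Cyc (suc α) (suc β)

arc? : ∀ α β x → Dec (Arc α β x)
arc? α β = cyc? (suc α) (suc β)

ind-≤-> : ∀ x a → ind (x <? suc a) + ind (a <? x) ≡ 1
ind-≤-> x a with <-≤-connex a x
... | inj₁ a<x rewrite when-no (x <? suc a) {1} (<⇒≱ a<x ∘ s≤s⁻¹) | when-yes (a <? x) {1} a<x = refl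
... | inj₂ x≤a rewrite when-yes (x <? suc a) {1} (s≤s x≤a) | when-no (a <? x) {1} (≤⇒≯ x≤a) = refl

-- Replacing an entry α by β changes the number of entries below r by [β < r] - [α < r] = [β < α] -
-- [r in (α, β]]. So the change takes one value off the arc and is one lower on it.
arc-count : ∀ α β r → ind (arc? α β r) + ind (β <? r) ≡ ind (α <? r) + ind (β <? α)
arc-count α β r = +-cancelʳ-≡ (ind (r <? suc α)) _ _ (begin
  ind (arc? α β r) + ind (β <? r) + ind (r <? suc α)   ≡⟨ swapLast (ind (arc? α β r)) (ind (β <? r)) (ind (r <? suc α)) ⟩
  ind (arc? α β r) + ind (r <? suc α) + ind (β <? r)   ≡⟨ cong (_+ ind (β <? r)) (cyc-count (suc α) (suc β) r) ⟩
  ind (r <? suc β) + ind (suc β <? suc α) + ind (β <? r) ≡⟨ swapLast (ind (r <? suc β)) (ind (suc β <? suc α)) (ind (β <? r)) ⟩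
  ind (r <? suc β) + ind (β <? r) + ind (suc β <? suc α) ≡⟨ cong₂ _+_ (trans (ind-≤-> r β) (sym (ind-≤-> r α))) (ind-cong (suc β <? suc α) (β <? α) s≤s⁻¹ s≤s) ⟩
  ind (r <? suc α) + ind (α <? r) + ind (β <? α)       ≡⟨ rotate (ind (r <? suc α)) (ind (α <? r)) (ind (β <? α)) ⟩
  ind (α <? r) + ind (β <? α) + ind (r <? suc α)       ∎)
  where
  open ≡-Reasoning
  swapLast : ∀ a b c → a + b + c ≡ a + c + b
  swapLast = solve-∀
  rotate : ∀ a b c → a + b + c ≡ b + c + a
  rotate = solve-∀

∉arc-count : ∀ α β {r} → ¬ Arc α β r → ind (β <? r) ≡ ind (α <? r) + ind (β <? α)
∉arc-count α β {r} r∉ = trans (cong (_+ ind (β <? r)) (sym (when-no (arc? α β r) r∉))) (arc-count α β r)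

-- For r in (α, γ], the interval [r, γ] is a final segment of that arc. An entry of u in [r, γ]
-- would thus lie in the arc that the choice of j keeps free.
arc-cyc⇒arc : ∀ {α γ r x} → Arc α γ r → Cyc r (suc γ) x → Arc α γ x
arc-cyc⇒arc (inj₁ (α≤γ , α<r , _))   (inj₁ (_ , r≤x , x≤γ))   = inj₁ (α≤γ , ≤-trans α<r r≤x , x≤γ)
arc-cyc⇒arc (inj₁ (_ , _ , r≤γ))     (inj₂ (γ<r , _))         = contradiction r≤γ (<⇒≯ γ<r)
arc-cyc⇒arc (inj₂ (γ<α , _))         (inj₁ (_ , _ , x≤γ))     = inj₂ (γ<α , inj₂ x≤γ)
arc-cyc⇒arc (inj₂ (γ<α , _))         (inj₂ (_ , inj₂ x≤γ))    = inj₂ (γ<α , inj₂ x≤γ)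
arc-cyc⇒arc (inj₂ (γ<α , inj₁ α<r))  (inj₂ (_ , inj₁ r≤x))    = inj₂ (γ<α , inj₁ (≤-trans α<r r≤x))
arc-cyc⇒arc (inj₂ (_ , inj₂ r≤γ))    (inj₂ (γ<r , inj₁ _))    = contradiction r≤γ (<⇒≯ γ<r)

arc-start : ∀ {α γ} → ¬ Arc α γ α
arc-start (inj₁ (_ , α<α , _))        = <-irrefl refl α<α
arc-start (inj₂ (_ , inj₁ α<α))       = <-irrefl refl α<α
arc-start (inj₂ (γ<α , inj₂ α≤γ))     = <⇒≱ γ<α α≤γ

arc-end : ∀ {α γ} → α ≢ γ → Arc α γ γ
arc-end {α} {γ} α≢γ with <-cmp α γ
... | tri< α<γ _ _ = inj₁ (s≤s (<⇒≤ α<γ) , α<γ , n<1+n γ)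
... | tri≈ _ α≡γ _ = contradiction α≡γ α≢γ
... | tri> _ _ γ<α = inj₂ (s≤s γ<α , inj₂ (n<1+n γ))

arc⇒cyc-end : ∀ {α γ r} → Arc α γ r → Cyc r (suc γ) γ
arc⇒cyc-end {γ = γ} (inj₁ (_ , _ , r≤γ))       = inj₁ (<⇒≤ r≤γ , s≤s⁻¹ r≤γ , n<1+n γ)
arc⇒cyc-end {γ = γ} (inj₂ (γ<α , inj₁ α<r))    = inj₂ (<-≤-trans γ<α α<r , inj₂ (n<1+n γ))
arc⇒cyc-end {γ = γ} (inj₂ (_ , inj₂ r≤γ))      = inj₁ (<⇒≤ r≤γ , s≤s⁻¹ r≤γ , n<1+n γ)

-- An initial segment stays inside its arc. This carries what is known on (u_i, v_i] over to (u_i,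
-- u_j].
arc-trans : ∀ {α β γ s} → Arc α γ β → Arc α β s → Arc α γ s
arc-trans (inj₁ (α≤γ , _ , β≤γ))      (inj₁ (_ , α<s , s≤β))     = inj₁ (α≤γ , α<s , <-≤-trans s≤β β≤γ)
arc-trans (inj₁ (_ , α<β , _))        (inj₂ (β<α , _))           = contradiction (m≤n⇒m≤1+n α<β) (<⇒≱ β<α)
arc-trans (inj₂ (γ<α , _))            (inj₁ (_ , α<s , _))       = inj₂ (γ<α , inj₁ α<s)
arc-trans (inj₂ (γ<α , _))            (inj₂ (_ , inj₁ α<s))      = inj₂ (γ<α , inj₁ α<s)
arc-trans (inj₂ (_ , inj₁ α<β))       (inj₂ (β<α , inj₂ _))      = contradiction (m≤n⇒m≤1+n α<β) (<⇒≱ β<α)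
arc-trans (inj₂ (γ<α , inj₂ β≤γ))     (inj₂ (_ , inj₂ s≤β))      = inj₂ (γ<α , inj₂ (<-≤-trans s≤β β≤γ))

-- r ↦ [β < r] − [α < r] takes two consecutive values.
threshold-variation : ∀ α β r s → ind (β <? r) + ind (α <? s) ≤ suc (ind (β <? s) + ind (α <? r))
threshold-variation α β r s with ≤-total α β
... | inj₁ α≤β = ≤-trans (+-mono-≤ (ind-mono (β <? r) (α <? r) (≤-<-trans α≤β)) (ind≤1 (α <? s)))
                         (≤-trans (≤-reflexive (+-comm (ind (α <? r)) 1)) (s≤s (m≤n+m (ind (α <? r)) (ind (β <? s)))))
... | inj₂ β≤α = +-mono-≤ (ind≤1 (β <? r)) (≤-trans (ind-mono (α <? s) (β <? s) (≤-<-trans β≤α)) (m≤m+n (ind (β <? s)) (ind (α <? r))))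

-- Counting in prefixes

count : ∀ {n} → Word n → ℕ → (Fin n → ℕ) → ℕ
count w k f = sum λ p → when (toℕ p <? k) (f (lookup w p))

below : ∀ {n} → ℕ → Fin n → ℕ
below r x = ind (toℕ x <? r)

count-+ : ∀ {n} (w : Word n) k f g → count w k (λ x → f x + g x) ≡ count w k f + count w k g
count-+ w k f g = trans (sum-cong-≗ λ p → when-+ (toℕ p <? k) (f (lookup w p)) (g (lookup w p)))
                        (∑-distrib-+ (λ p → when (toℕ p <? k) (f (lookup w p))) (λ p → when (toℕ p <? k) (g (lookup w p))))

count-cong : ∀ {n} (w : Word n) k {f g} → (∀ x → f x ≡ g x) → count w k f ≡ count w k g
count-cong w k f≡g = sum-cong-≗ λ p → cong (when (toℕ p <? k)) (f≡g (lookup w p))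

count-suc : ∀ {n} (w : Word n) (k : Fin n) f → count w (suc (toℕ k)) f ≡ count w (toℕ k) f + f (lookup w k)
count-suc w k f = begin
  count w (suc (toℕ k)) f     ≡⟨ +-identityʳ _ ⟨
  count w (suc (toℕ k)) f + 0 ≡⟨ cong (count w (suc (toℕ k)) f +_) (when-no (toℕ k <? toℕ k) (<-irrefl refl)) ⟨
  count w (suc (toℕ k)) f + when (toℕ k <? toℕ k) (f (lookup w k)) ≡⟨ sum-differ₁ k agree ⟩
  count w (toℕ k) f + when (toℕ k <? suc (toℕ k)) (f (lookup w k)) ≡⟨ cong (count w (toℕ k) f +_) (when-yes (toℕ k <? suc (toℕ k)) ≤-refl) ⟩
  count w (toℕ k) f + f (lookup w k) ∎
  where
  open ≡-Reasoning
  agree : ∀ p → p ≢ k → when (toℕ p <? suc (toℕ k)) (f (lookup w p)) ≡ when (toℕ p <? toℕ k) (f (lookup w p))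
  agree p p≢k with <-cmp (toℕ p) (toℕ k)
  ... | tri< p<k _ _ = trans (when-yes (toℕ p <? suc (toℕ k)) (m<n⇒m<1+n p<k)) (sym (when-yes (toℕ p <? toℕ k) p<k))
  ... | tri≈ _ p≡k _ = contradiction (toℕ-injective p≡k) p≢k
  ... | tri> p≮k _ k<p = trans (when-no (toℕ p <? suc (toℕ k)) (<⇒≱ k<p ∘ s≤s⁻¹)) (sym (when-no (toℕ p <? toℕ k) p≮k))

module _ {n} (w : Word n) {i j : Fin n} (i<j : i F.< j) where
  private
    i≢j = <⇒≢ᶠ i<j
    α = toℕ (lookup w i)
    β = toℕ (lookup w j)

  count-swap : ∀ k f → count (swapPos w i j) k f + (when (toℕ i <? k) (f (lookup w i)) + when (toℕ j <? k) (f (lookup w j)))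
                       ≡ count w k f + (when (toℕ i <? k) (f (lookup w j)) + when (toℕ j <? k) (f (lookup w i)))
  count-swap k f = trans
    (sum-differ₂ i j i≢j λ p p≢i p≢j → cong (λ x → when (toℕ p <? k) (f x)) (lookup-swap-≢ w i≢j p≢i p≢j))
    (cong (count w k f +_) (cong₂ (λ x y → when (toℕ i <? k) (f x) + when (toℕ j <? k) (f y)) (lookup-swapˡ w i≢j) (lookup-swapʳ w i≢j)))

  -- With positions counted from 0, the prefix of length `suc k` contains position `i` but not `j`
  -- exactly when i ≤ k < j; there the swap exchanges the entry α for β.
  below-swap-inside : ∀ k r → toℕ i ≤ k → k < toℕ j →
    count (swapPos w i j) (suc k) (below r) + ind (α <? r) ≡ count w (suc k) (below r) + ind (β <? r)
  below-swap-inside k r i≤k k<j = begin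
    count (swapPos w i j) (suc k) (below r) + ind (α <? r)
      ≡⟨ cong (count (swapPos w i j) (suc k) (below r) +_) (drop (below r (lookup w i)) (below r (lookup w j))) ⟨
    _ ≡⟨ count-swap (suc k) (below r) ⟩
    _ ≡⟨ cong (count w (suc k) (below r) +_) (drop (below r (lookup w j)) (below r (lookup w i))) ⟩
    count w (suc k) (below r) + ind (β <? r) ∎
    where
    open ≡-Reasoning
    drop : ∀ x y → when (toℕ i <? suc k) x + when (toℕ j <? suc k) y ≡ x
    drop x y = trans (cong₂ _+_ (when-yes (toℕ i <? suc k) (s≤s i≤k)) (when-no (toℕ j <? suc k) (<⇒≱ k<j ∘ s≤s⁻¹))) (+-identityʳ x)

  -- Such a prefix contains both swapped positions or neither, so its set of entries is unchanged.
  count-swap-outside : ∀ k f → ¬ (toℕ i ≤ k × k < toℕ j) → count (swapPos w i j) (suc k) f ≡ count w (suc k) f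
  count-swap-outside k f k∉ with <-≤-connex k (toℕ i) | <-≤-connex k (toℕ j)
  ... | inj₂ i≤k | inj₁ k<j = contradiction (i≤k , k<j) k∉
  ... | inj₁ k<i | _ = begin
    count (swapPos w i j) (suc k) f            ≡⟨ +-identityʳ _ ⟨
    count (swapPos w i j) (suc k) f + (0 + 0)  ≡⟨ cong₂ (λ x y → count (swapPos w i j) (suc k) f + (x + y)) (when-no (toℕ i <? suc k) i≰k) (when-no (toℕ j <? suc k) j≰k) ⟨
    _                                          ≡⟨ count-swap (suc k) f ⟩
    _                                          ≡⟨ cong₂ (λ x y → count w (suc k) f + (x + y)) (when-no (toℕ i <? suc k) i≰k) (when-no (toℕ j <? suc k) j≰k) ⟩
    count w (suc k) f + (0 + 0)                ≡⟨ +-identityʳ _ ⟩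
    count w (suc k) f                          ∎
    where
    open ≡-Reasoning
    i≰k : ¬ toℕ i < suc k
    i≰k = <⇒≱ k<i ∘ s≤s⁻¹
    j≰k : ¬ toℕ j < suc k
    j≰k = <⇒≱ (<-trans k<i i<j) ∘ s≤s⁻¹
  ... | inj₂ i≤k | inj₂ j≤k = +-cancelʳ-≡ (f (lookup w i) + f (lookup w j)) _ _ (begin
    count (swapPos w i j) (suc k) f + (f (lookup w i) + f (lookup w j))
      ≡⟨ cong₂ (λ x y → count (swapPos w i j) (suc k) f + (x + y)) (when-yes (toℕ i <? suc k) (s≤s i≤k)) (when-yes (toℕ j <? suc k) (s≤s j≤k)) ⟨
    _ ≡⟨ count-swap (suc k) f ⟩
    _ ≡⟨ cong₂ (λ x y → count w (suc k) f + (x + y)) (when-yes (toℕ i <? suc k) (s≤s i≤k)) (when-yes (toℕ j <? suc k) (s≤s j≤k)) ⟩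
    count w (suc k) f + (f (lookup w j) + f (lookup w i)) ≡⟨ cong (count w (suc k) f +_) (+-comm (f (lookup w j)) _) ⟩
    count w (suc k) f + (f (lookup w i) + f (lookup w j)) ∎)
    where open ≡-Reasoning

-- The minimum condition and the potential

-- r minimises s ↦ |u[k] ∩ [0,s)| − |v[k] ∩ [0,s)|
Minimises : ∀ {n} → Word n → Word n → ℕ → ℕ → Set
Minimises u v k r = ∀ s → count u k (below r) + count v k (below s) ≤ count u k (below s) + count v k (below r)

Minimal : ∀ {n} → Word n → Word n → (Fin n → ℕ) → Set
Minimal u v a = ∀ k → Minimises u v (suc (toℕ k)) (a k)

-- The function for (u, v) is the sum of those for (u, w) and (w, v), and a common minimiser of two
-- functions minimises their sum.
Minimal-trans : ∀ {n} {u v w : Word n} {a} → Minimal u w a → Minimal w v a → Minimal u v a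
Minimal-trans {u = u} {v} {w} {a} uw wv k s =
  combine (c u (a k)) (c w (a k)) (c v (a k)) (c u s) (c w s) (c v s) (uw k s) (wv k s)
  where
  c : Word _ → ℕ → ℕ
  c x r = count x (suc (toℕ k)) (below r)
  combine : ∀ ua wa va us ws vs → ua + ws ≤ us + wa → wa + vs ≤ ws + va → ua + vs ≤ us + va
  combine ua wa va us ws vs h₁ h₂ = ≤-shift (+-mono-≤ h₁ h₂) (balance ua wa va us ws vs)
    where
    balance : ∀ ua wa va us ws vs → ua + vs + (us + wa + (ws + va)) ≡ us + va + (ua + ws + (wa + vs))
    balance = solve-∀

prefixSum : ∀ {n} → (Fin n → ℕ) → Word n → ℕ
prefixSum a w = sum λ k → count w (suc (toℕ k)) (below (a k))

Φ : ∀ {n} → (Fin n → ℕ) → Word n → ℕ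
Φ a w = inv w + 2 * prefixSum a w

-- Swapping back turns the inverted pair into a non-inverted one, so `inv-swap` applies to the
-- swapped word.
inv-swap-quantum : ∀ {n} (w : Word n) → IsPerm w → ∀ {i j} → i F.< j → lookup w j F.< lookup w i →
                   inv w ≡ suc (inv (swapPos w i j)) + 2 * sum (between (swapPos w i j) i j)
inv-swap-quantum w w-perm {i} {j} i<j wj<wi = begin
  inv w                             ≡⟨ cong inv (swapPos-involutive w i≢j) ⟨
  inv (swapPos (swapPos w i j) i j) ≡⟨ inv-swap {w = swapPos w i j} (swapPos-perm w i≢j w-perm) i<j
                                         (subst₂ F._<_ (sym (lookup-swapˡ w i≢j)) (sym (lookup-swapʳ w i≢j)) wj<wi) ⟩
  suc (inv (swapPos w i j)) + 2 * sum (between (swapPos w i j) i j) ∎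
  where
  open ≡-Reasoning
  i≢j = <⇒≢ᶠ i<j

inside? : ∀ {n} (i j k : Fin n) → Dec (toℕ i ≤ toℕ k × toℕ k < toℕ j)
inside? i j k = toℕ i ≤? toℕ k ×-dec toℕ k <? toℕ j

sum-inside : ∀ {n} (i j : Fin n) → i F.< j → sum (λ k → ind (inside? i j k)) ≡ toℕ j ∸ toℕ i
sum-inside i j i<j = sym (trans (cong (_∸ toℕ i) (sym (sum-interval (toℕ i) (toℕ j) (<⇒≤ i<j) (<⇒≤ (toℕ<n j)))))
                                (m+n∸n≡m _ (toℕ i)))

edge-perm : ∀ {n} {w w′ : Word n} → IsPerm w → QBEdge w w′ → IsPerm w′
edge-perm {w = w} w-perm (i , j , i<j , refl , _) = swapPos-perm w (<⇒≢ᶠ i<j) w-perm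

-- An upward edge puts a larger entry into the altered prefixes, so no count of entries below a_k
-- grows. A quantum edge loses 2(j - i) - 1 inversions, while each of the j - i altered prefixes
-- gains at most one entry below a_k; the weight 2 in `Φ` balances the two up to 1.
edge-Φ : ∀ {n} {w w′ : Word n} → IsPerm w → QBEdge w w′ → ∀ a → Φ a w′ ≤ suc (Φ a w)
edge-Φ {w = w} w-perm (i , j , i<j , refl , inj₁ up) a with <-cmp (toℕ (lookup w i)) (toℕ (lookup w j))
... | tri≈ _ wi≡wj _ = contradiction wi≡wj (lookup-≢ w w-perm (<⇒≢ᶠ i<j))
-- Swapping an inverted pair strictly lowers the number of inversions, against `up`.
... | tri> _ _ wj<wi = contradiction (≤-trans (m≤m+n (suc (inv (swapPos w i j))) _) (≤-reflexive (sym (inv-swap-quantum w w-perm i<j wj<wi))))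
                                     (<⇒≱ (≤-trans (n<1+n (suc (inv w))) (≤-reflexive (cong suc (sym up)))) ∘ m≤n⇒m≤1+n)
... | tri< wi<wj _ _ = +-mono-≤ (≤-reflexive up) (*-monoʳ-≤ 2 (sum-mono decrease))
  where
  decrease : ∀ k → count (swapPos w i j) (suc (toℕ k)) (below (a k)) ≤ count w (suc (toℕ k)) (below (a k))
  decrease k with inside? i j k
  ... | no k∉          = ≤-reflexive (count-swap-outside w i<j (toℕ k) (below (a k)) k∉)
  ... | yes (i≤k , k<j) = ≤-shift (ind-mono (toℕ (lookup w j) <? a k) (toℕ (lookup w i) <? a k) (<-trans wi<wj))
                                 (below-swap-inside w i<j (toℕ k) (a k) i≤k k<j)
edge-Φ {w = w} w-perm (i , j , i<j , refl , inj₂ quantum) a = begin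
  inv w′ + 2 * prefixSum a w′  ≤⟨ +-monoʳ-≤ (inv w′) (*-monoʳ-≤ 2 (sum-mono increase)) ⟩
  inv w′ + 2 * sum (λ k → ind (inside? i j k) + count w (suc (toℕ k)) (below (a k)))
    ≡⟨ cong (λ s → inv w′ + 2 * s) (∑-distrib-+ (λ k → ind (inside? i j k)) _) ⟩
  inv w′ + 2 * (sum (λ k → ind (inside? i j k)) + prefixSum a w)
    ≡⟨ cong (λ s → inv w′ + 2 * (s + prefixSum a w)) (sum-inside i j i<j) ⟩
  inv w′ + 2 * ((toℕ j ∸ toℕ i) + prefixSum a w) ≡⟨ distrib (inv w′) (toℕ j ∸ toℕ i) (prefixSum a w) ⟩
  inv w′ + 2 * (toℕ j ∸ toℕ i) + 2 * prefixSum a w ≡⟨ cong (_+ 2 * prefixSum a w) quantum ⟩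
  suc (Φ a w) ∎
  where
  open ≤-Reasoning
  w′ = swapPos w i j
  distrib : ∀ x y z → x + 2 * (y + z) ≡ x + 2 * y + 2 * z
  distrib = solve-∀
  increase : ∀ k → count w′ (suc (toℕ k)) (below (a k)) ≤ ind (inside? i j k) + count w (suc (toℕ k)) (below (a k))
  increase k with inside? i j k
  ... | no k∉           = ≤-trans (≤-reflexive (count-swap-outside w i<j (toℕ k) (below (a k)) k∉)) (m≤n+m _ (ind (inside? i j k)))
  ... | yes (i≤k , k<j) = begin
    count w′ (suc (toℕ k)) (below (a k))                                 ≤⟨ m≤m+n _ (ind (toℕ (lookup w i) <? a k)) ⟩
    count w′ (suc (toℕ k)) (below (a k)) + ind (toℕ (lookup w i) <? a k) ≡⟨ below-swap-inside w i<j (toℕ k) (a k) i≤k k<j ⟩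
    count w (suc (toℕ k)) (below (a k)) + ind (toℕ (lookup w j) <? a k)  ≤⟨ +-monoʳ-≤ _ (ind≤1 (toℕ (lookup w j) <? a k)) ⟩
    count w (suc (toℕ k)) (below (a k)) + 1                              ≡⟨ +-comm _ 1 ⟩
    1 + count w (suc (toℕ k)) (below (a k))                              ≡⟨ cong (_+ count w (suc (toℕ k)) (below (a k))) (when-yes (inside? i j k) (i≤k , k<j)) ⟨
    ind (inside? i j k) + count w (suc (toℕ k)) (below (a k))            ∎

path-Φ : ∀ {n} {x y : Word n} {d} → IsPerm x → QBPath x y d → ∀ a → Φ a y ≤ d + Φ a x
path-Φ x-perm here a = ≤-refl
path-Φ {x = x} {y} {suc d} x-perm (there {y = z} e p) a = begin
  Φ a y             ≤⟨ path-Φ (edge-perm x-perm e) p a ⟩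
  d + Φ a z         ≤⟨ +-monoʳ-≤ d (edge-Φ x-perm e a) ⟩
  d + suc (Φ a x)   ≡⟨ +-suc d (Φ a x) ⟩
  suc d + Φ a x     ∎
  where open ≤-Reasoning

-- One step towards the target

least : ∀ {n} {P : Fin n → Set} → Decidable P → ∀ i → P i → ∃ λ i → P i × (∀ j → j F.< i → ¬ P j)
least {suc n} P? i Pi with P? zero
... | yes P0 = zero , P0 , λ _ ()
least {suc n} P? zero    P0 | no ¬P0 = contradiction P0 ¬P0
least {suc n} P? (suc i) Pi | no ¬P0 with least (P? ∘ suc) i Pi
... | m , Pm , below-m = suc m , Pm , λ { zero _ → ¬P0 ; (suc j) (s≤s j<m) → below-m j j<m }

-- Pigeonhole: removing a missed value would make the word an injection into a set with one element
-- fewer.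
perm-surjective : ∀ {n} (w : Word n) → IsPerm w → ∀ x → ∃ λ p → lookup w p ≡ x
perm-surjective w w-perm x with any? (λ p → lookup w p ≟ x)
... | yes hit = hit
perm-surjective {suc n} w w-perm x | no miss =
  contradiction (injective⇒≤ {f = λ p → F.punchOut (missed p)} λ {p} {q} eq → w-perm p q (punchOut-injective (missed p) (missed q) eq))
                (<⇒≱ (n<1+n n))
  where
  missed : ∀ p → x ≢ lookup w p
  missed p eq = miss (p , sym eq)

-- u and v agree before i; from position i on, v meets [r , v_i] and u does not.
separation : ∀ {n} (u v : Word n) i k {r} → (∀ p → p F.< i → lookup u p ≡ lookup v p) → toℕ i ≤ k →
  (∀ p → i F.≤ p → toℕ p ≤ k → ¬ Cyc r (suc (toℕ (lookup v i))) (toℕ (lookup u p))) →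
  Cyc r (suc (toℕ (lookup v i))) (toℕ (lookup v i)) →
  count u (suc k) (below (suc (toℕ (lookup v i)))) + count v (suc k) (below r)
  < count u (suc k) (below r) + count v (suc k) (below (suc (toℕ (lookup v i))))
separation {n} u v i k {r} agree i≤k avoid γ∈ = subst₂ _<_
  (∑-distrib-+ (λ p → when (toℕ p <? suc k) (below (suc γ) (lookup u p))) (λ p → when (toℕ p <? suc k) (below r (lookup v p))))
  (∑-distrib-+ (λ p → when (toℕ p <? suc k) (below r (lookup u p))) (λ p → when (toℕ p <? suc k) (below (suc γ) (lookup v p))))
  (sum-mono-< i weak strict-at-i)
  where
  open ≤-Reasoning
  γ = toℕ (lookup v i)
  lhs rhs : Fin n → ℕ
  lhs p = when (toℕ p <? suc k) (below (suc γ) (lookup u p)) + when (toℕ p <? suc k) (below r (lookup v p))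
  rhs p = when (toℕ p <? suc k) (below r (lookup u p)) + when (toℕ p <? suc k) (below (suc γ) (lookup v p))

  -- Moving the threshold from r to γ + 1 changes a count by the number of entries in [r, γ], up to
  -- a wrap-around term common to both words. The entry x contributes nothing, and y contributes its
  -- indicator.
  exchange : ∀ x y → ¬ Cyc r (suc γ) x → ind (cyc? r (suc γ) y) + (ind (x <? suc γ) + ind (y <? r)) ≡ ind (x <? r) + ind (y <? suc γ)
  exchange x y x∉ = +-cancelʳ-≡ (ind (suc γ <? r)) _ _ (E.begin
    ind (cyc? r (suc γ) y) + (ind (x <? suc γ) + ind (y <? r)) + ind (suc γ <? r)
      E.≡⟨ regroup (ind (cyc? r (suc γ) y)) (ind (x <? suc γ)) (ind (y <? r)) (ind (suc γ <? r)) ⟩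
    (ind (cyc? r (suc γ) y) + ind (y <? r)) + (ind (x <? suc γ) + ind (suc γ <? r))
      E.≡⟨ cong₂ _+_ (cyc-count r (suc γ) y) (trans (sym (cyc-count r (suc γ) x)) (cong (_+ ind (x <? r)) (when-no (cyc? r (suc γ) x) x∉))) ⟩
    (ind (y <? suc γ) + ind (suc γ <? r)) + ind (x <? r)
      E.≡⟨ rotate (ind (y <? suc γ)) (ind (suc γ <? r)) (ind (x <? r)) ⟩
    ind (x <? r) + ind (y <? suc γ) + ind (suc γ <? r) E.∎)
    where
    module E = ≡-Reasoning
    regroup : ∀ a b c d → a + (b + c) + d ≡ (a + c) + (b + d)
    regroup = solve-∀
    rotate : ∀ a b c → (a + b) + c ≡ c + a + b
    rotate = solve-∀

  weak : ∀ p → lhs p ≤ rhs p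
  weak p = subst₂ _≤_ (when-+ (toℕ p <? suc k) _ _) (when-+ (toℕ p <? suc k) _ _) (when-mono (toℕ p <? suc k) (bound ∘ s≤s⁻¹))
    where
    bound : toℕ p ≤ k → below (suc γ) (lookup u p) + below r (lookup v p) ≤ below r (lookup u p) + below (suc γ) (lookup v p)
    bound p≤k with <-≤-connex (toℕ p) (toℕ i)
    ... | inj₁ p<i rewrite agree p p<i = ≤-reflexive (+-comm (below (suc γ) (lookup v p)) _)
    ... | inj₂ i≤p = ≤-trans (m≤n+m _ (ind (cyc? r (suc γ) (toℕ (lookup v p))))) (≤-reflexive (exchange (toℕ (lookup u p)) (toℕ (lookup v p)) (avoid p i≤p p≤k)))

  -- The entry of v at `i` is γ, which lies in [r, γ], so this position makes the inequality strict.
  strict-at-i : lhs i < rhs i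
  strict-at-i = begin-strict
    lhs i ≡⟨ cong₂ _+_ (when-yes (toℕ i <? suc k) (s≤s i≤k)) (when-yes (toℕ i <? suc k) (s≤s i≤k)) ⟩
    ind (toℕ (lookup u i) <? suc γ) + ind (γ <? r) <⟨ n<1+n _ ⟩
    suc (ind (toℕ (lookup u i) <? suc γ) + ind (γ <? r)) ≡⟨ cong (_+ (ind (toℕ (lookup u i) <? suc γ) + ind (γ <? r))) (when-yes (cyc? r (suc γ) γ) {1} γ∈) ⟨
    ind (cyc? r (suc γ) γ) + (ind (toℕ (lookup u i) <? suc γ) + ind (γ <? r)) ≡⟨ exchange (toℕ (lookup u i)) γ (avoid i ≤-refl i≤k) ⟩
    ind (toℕ (lookup u i) <? r) + ind (γ <? suc γ) ≡⟨ cong₂ _+_ (when-yes (toℕ i <? suc k) (s≤s i≤k)) (when-yes (toℕ i <? suc k) (s≤s i≤k)) ⟨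
    rhs i ∎

module Descent {n} {u v : Word n} (u-perm : IsPerm u) {a : Fin n → ℕ} (minimal : Minimal u v a)
  {i j : Fin n} (i<j : i F.< j)
  (agree : ∀ p → p F.< i → lookup u p ≡ lookup v p)
  (j∈ : Arc (toℕ (lookup u i)) (toℕ (lookup v i)) (toℕ (lookup u j)))
  (first : ∀ p → i F.< p → p F.< j → ¬ Arc (toℕ (lookup u i)) (toℕ (lookup v i)) (toℕ (lookup u p)))
  where
  private
    α = toℕ (lookup u i)
    β = toℕ (lookup u j)
    γ = toℕ (lookup v i)
    u′ = swapPos u i j
    i≢j = <⇒≢ᶠ i<j

    c : Word n → Fin n → ℕ → ℕ
    c w k r = count w (suc (toℕ k)) (below r)

    Inside : Fin n → Set
    Inside k = toℕ i ≤ toℕ k × toℕ k < toℕ j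

    -- In other words f_k(γ + 1) < f_k(r), so no r in (α, γ] minimises f_k. From position `i` up to
    -- k, u has no entry in [r, γ]: α is outside the arc, and j is the first later position with an
    -- entry in it.
    separated : ∀ {k r} → Inside k → Arc α γ r → c u k (suc γ) + c v k r < c u k r + c v k (suc γ)
    separated {k} {r} (i≤k , k<j) r∈ = separation u v i (toℕ k) agree i≤k avoid (arc⇒cyc-end r∈)
      where
      avoid : ∀ p → i F.≤ p → toℕ p ≤ toℕ k → ¬ Cyc r (suc γ) (toℕ (lookup u p))
      avoid p i≤p p≤k p∈ with i ≟ p
      ... | yes refl = arc-start (arc-cyc⇒arc r∈ p∈)
      ... | no i≢p   = first p (≤∧≢⇒< i≤p (i≢p ∘ toℕ-injective)) (≤-<-trans p≤k k<j) (arc-cyc⇒arc r∈ p∈)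

    a∉ : ∀ k → Inside k → ¬ Arc α β (a k)
    a∉ k k∈ ak∈ = <⇒≱ (separated k∈ (arc-trans j∈ ak∈)) (minimal k (suc γ))

    -- f_k(a_k) ≤ f_k(γ + 1) < f_k(s). The swap will use up this spare unit.
    strictly-above : ∀ k {s} → Inside k → Arc α β s → suc (c u k (a k) + c v k s) ≤ c u k s + c v k (a k)
    strictly-above k {s} k∈ s∈ = combine (c u k (a k)) (c v k (a k)) (c u k s) (c v k s) (c u k (suc γ)) (c v k (suc γ))
                                         (separated k∈ (arc-trans j∈ s∈)) (minimal k (suc γ))
      where
      balance : ∀ ua va us vs uγ vγ → suc (ua + vs) + (us + vγ + (uγ + va)) ≡ us + va + (suc (uγ + vs) + (ua + vγ))
      balance = solve-∀
      combine : ∀ ua va us vs uγ vγ → suc (uγ + vs) ≤ us + vγ → ua + vγ ≤ uγ + va → suc (ua + vs) ≤ us + va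
      combine ua va us vs uγ vγ h₁ h₂ = ≤-shift (+-mono-≤ h₁ h₂) (balance ua va us vs uγ vγ)

    -- Here δ is the room before the swap, f_k(a_k) + δ ≤ f_k(s), and the last hypothesis says that
    -- the swap raises f_k(a_k) - f_k(s) by at most δ.
    transfer : ∀ δ x′ x va y′ y vs αa βa αs βs → x′ + αa ≡ x + βa → y′ + αs ≡ y + βs →
               δ + (x + vs) ≤ y + va → βa + αs ≤ δ + (βs + αa) → x′ + vs ≤ y′ + va
    transfer δ x′ x va y′ y vs αa βa αs βs h₁ h₂ h₃ h₄ =
      ≤-shift (+-mono-≤ (+-mono-≤ (≤-reflexive h₁) (≤-reflexive (sym h₂))) (+-mono-≤ h₃ h₄)) (balance δ x′ x va y′ y vs αa βa αs βs)
      where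
      balance : ∀ δ x′ x va y′ y vs αa βa αs βs →
        x′ + vs + ((x + βa + (y′ + αs)) + (y + va + (δ + (βs + αa)))) ≡ y′ + va + ((x′ + αa + (y + βs)) + (δ + (x + vs) + (βa + αs)))
      balance = solve-∀

  -- By `a∉` the threshold a_k is off the arc (α, β]. At another s off the arc, f_k changes by the
  -- same amount; at s on the arc it drops by one relative to a_k, which `strictly-above` allows.
  minimal-swap : Minimal u′ v a
  minimal-swap k s with inside? i j k
  ... | no k∉ = subst₂ (λ x y → x + c v k s ≤ y + c v k (a k)) (sym (count-swap-outside u i<j (toℕ k) (below (a k)) k∉))
                       (sym (count-swap-outside u i<j (toℕ k) (below s) k∉)) (minimal k s)
  ... | yes k∈@(i≤k , k<j) with arc? α β s
  ...   | yes s∈ = transfer 1 (c u′ k (a k)) (c u k (a k)) (c v k (a k)) (c u′ k s) (c u k s) (c v k s) (ind (α <? a k)) (ind (β <? a k)) (ind (α <? s)) (ind (β <? s))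
                     (below-swap-inside u i<j (toℕ k) (a k) i≤k k<j) (below-swap-inside u i<j (toℕ k) s i≤k k<j)
                     (strictly-above k k∈ s∈) (threshold-variation α β (a k) s)
  ...   | no s∉  = transfer 0 (c u′ k (a k)) (c u k (a k)) (c v k (a k)) (c u′ k s) (c u k s) (c v k s) (ind (α <? a k)) (ind (β <? a k)) (ind (α <? s)) (ind (β <? s))
                     (below-swap-inside u i<j (toℕ k) (a k) i≤k k<j) (below-swap-inside u i<j (toℕ k) s i≤k k<j)
                     (minimal k s) (≤-reflexive same)
    where
    open ≡-Reasoning
    same : ind (β <? a k) + ind (α <? s) ≡ ind (β <? s) + ind (α <? a k)
    same = begin
      ind (β <? a k) + ind (α <? s)                ≡⟨ cong (_+ ind (α <? s)) (∉arc-count α β (a∉ k k∈)) ⟩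
      ind (α <? a k) + ind (β <? α) + ind (α <? s) ≡⟨ reverse (ind (α <? a k)) (ind (β <? α)) (ind (α <? s)) ⟩
      ind (α <? s) + ind (β <? α) + ind (α <? a k) ≡⟨ cong (_+ ind (α <? a k)) (∉arc-count α β s∉) ⟨
      ind (β <? s) + ind (α <? a k)                ∎
      where
      reverse : ∀ x y z → x + y + z ≡ z + y + x
      reverse = solve-∀

  private
    -- As a_k is off the arc, the change at a_k is 0 for an upward step and 1 for a quantum step,
    -- the extreme values in `edge-Φ`. This is why `Φ` rises by exactly 1.
    count-inside : ∀ k → Inside k → c u′ k (a k) ≡ c u k (a k) + ind (β <? α)
    count-inside k k∈@(i≤k , k<j) = +-cancelʳ-≡ (ind (α <? a k)) _ _ (begin
      c u′ k (a k) + ind (α <? a k)                  ≡⟨ below-swap-inside u i<j (toℕ k) (a k) i≤k k<j ⟩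
      c u k (a k) + ind (β <? a k)                   ≡⟨ cong (c u k (a k) +_) (trans (∉arc-count α β (a∉ k k∈)) (+-comm (ind (α <? a k)) (ind (β <? α)))) ⟩
      c u k (a k) + (ind (β <? α) + ind (α <? a k))  ≡⟨ +-assoc (c u k (a k)) _ _ ⟨
      c u k (a k) + ind (β <? α) + ind (α <? a k)    ∎)
      where open ≡-Reasoning

    middle∉ : ∀ p → i F.< p → p F.< j → ¬ Arc α β (toℕ (lookup u p))
    middle∉ p i<p p<j p∈ = first p i<p p<j (arc-trans j∈ p∈)

  step-bruhat : α < β → QBEdge u u′ × Φ a u′ ≡ suc (Φ a u)
  step-bruhat α<β = (i , j , i<j , refl , inj₁ up) , cong₂ (λ x y → x + 2 * y) up (sum-cong-≗ same)
    where
    none : ∀ q → between u i j q ≡ 0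
    none q = when-no ((i F.<? q ×-dec q F.<? j) ×-dec (lookup u i F.<? lookup u q ×-dec lookup u q F.<? lookup u j))
      λ ((i<q , q<j) , (α<q , q<β)) → middle∉ q i<q q<j (inj₁ (s≤s (<⇒≤ α<β) , α<q , m<n⇒m<1+n q<β))
    up : inv u′ ≡ suc (inv u)
    up = trans (inv-swap {w = u} u-perm i<j α<β) (trans (cong (λ x → suc (inv u) + 2 * x) (sum-≡0 none)) (+-identityʳ _))
    same : ∀ k → c u′ k (a k) ≡ c u k (a k)
    same k with inside? i j k
    ... | no k∉  = count-swap-outside u i<j (toℕ k) (below (a k)) k∉
    ... | yes k∈ = trans (count-inside k k∈) (trans (cong (c u k (a k) +_) (when-no (β <? α) (<⇒≯ α<β))) (+-identityʳ _))

  -- Now (α, β] wraps around, and its complement is the set of values in (β, α]. Entries of u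
  -- strictly between positions `i` and `j` avoid the arc and differ from α, so all of them lie
  -- strictly between the two swapped values.
  step-quantum : β < α → QBEdge u u′ × Φ a u′ ≡ suc (Φ a u)
  step-quantum β<α = (i , j , i<j , refl , inj₂ down) , (begin
      inv u′ + 2 * prefixSum a u′ ≡⟨ cong (λ s → inv u′ + 2 * s) (trans (sum-cong-≗ shifted) (∑-distrib-+ (λ k → ind (inside? i j k)) (λ k → c u k (a k)))) ⟩
      inv u′ + 2 * (sum (λ k → ind (inside? i j k)) + prefixSum a u) ≡⟨ cong (λ s → inv u′ + 2 * (s + prefixSum a u)) (sum-inside i j i<j) ⟩
      inv u′ + 2 * ((toℕ j ∸ toℕ i) + prefixSum a u) ≡⟨ distrib (inv u′) (toℕ j ∸ toℕ i) (prefixSum a u) ⟩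
      inv u′ + 2 * (toℕ j ∸ toℕ i) + 2 * prefixSum a u ≡⟨ cong (_+ 2 * prefixSum a u) down ⟩
      suc (Φ a u) ∎)
    where
    open ≡-Reasoning
    distrib : ∀ x y z → x + 2 * (y + z) ≡ x + 2 * y + 2 * z
    distrib = solve-∀
    rearrange : ∀ x y → x + 2 * suc y ≡ suc (suc x + 2 * y)
    rearrange = solve-∀

    all-between : ∀ q → between u′ i j q ≡ ind (suc (toℕ i) ≤? toℕ q ×-dec toℕ q <? toℕ j)
    all-between q = ind-cong ((i F.<? q ×-dec q F.<? j) ×-dec (lookup u′ i F.<? lookup u′ q ×-dec lookup u′ q F.<? lookup u′ j))
                             (suc (toℕ i) ≤? toℕ q ×-dec toℕ q <? toℕ j) proj₁ (λ q∈ → q∈ , inner q∈)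
      where
      inner : i F.< q × q F.< j → lookup u′ i F.< lookup u′ q × lookup u′ q F.< lookup u′ j
      inner (i<q , q<j)
        rewrite lookup-swapˡ u i≢j | lookup-swapʳ u i≢j | lookup-swap-≢ u i≢j (≢-sym (<⇒≢ᶠ i<q)) (<⇒≢ᶠ q<j) =
        ≰⇒> (λ q≤β → middle∉ q i<q q<j (inj₂ (s≤s β<α , inj₂ (s≤s q≤β)))) ,
        ≤∧≢⇒< (≮⇒≥ λ α<q → middle∉ q i<q q<j (inj₂ (s≤s β<α , inj₁ α<q))) (lookup-≢ u u-perm (≢-sym (<⇒≢ᶠ i<q)))

    width : toℕ j ∸ toℕ i ≡ suc (sum (between u′ i j))
    width = trans (cong (_∸ toℕ i) (sym (trans (cong (_+ suc (toℕ i)) (sum-cong-≗ all-between)) (sum-interval (suc (toℕ i)) (toℕ j) i<j (<⇒≤ (toℕ<n j))))))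
      (trans (cong (_∸ toℕ i) (+-suc _ (toℕ i))) (m+n∸n≡m (suc (sum (between u′ i j))) (toℕ i)))

    down : inv u′ + 2 * (toℕ j ∸ toℕ i) ≡ suc (inv u)
    down = begin
      inv u′ + 2 * (toℕ j ∸ toℕ i)                 ≡⟨ cong (λ x → inv u′ + 2 * x) width ⟩
      inv u′ + 2 * suc (sum (between u′ i j))      ≡⟨ rearrange (inv u′) (sum (between u′ i j)) ⟩
      suc (suc (inv u′) + 2 * sum (between u′ i j)) ≡⟨ cong suc (inv-swap-quantum u u-perm i<j β<α) ⟨
      suc (inv u)                                  ∎

    shifted : ∀ k → c u′ k (a k) ≡ ind (inside? i j k) + c u k (a k)
    shifted k with inside? i j k
    ... | no k∉  = trans (count-swap-outside u i<j (toℕ k) (below (a k)) k∉) (cong (_+ c u k (a k)) (sym (when-no (inside? i j k) k∉)))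
    ... | yes k∈ = trans (count-inside k k∈) (trans (+-comm (c u k (a k)) _)
                     (cong (_+ c u k (a k)) (trans (when-yes (β <? α) β<α) (sym (when-yes (inside? i j k) k∈)))))

  step : QBEdge u u′ × Φ a u′ ≡ suc (Φ a u)
  step with <-cmp α β
  ... | tri< α<β _ _ = step-bruhat α<β
  ... | tri≈ _ α≡β _ = contradiction α≡β (lookup-≢ u u-perm i≢j)
  ... | tri> _ _ β<α = step-quantum β<α

-- A candidate for `j` always exists. The value v_i occurs in u at a position m after `i`, because u
-- and v agree before `i` and v is injective; and v_i is the closed end of the arc (u_i, v_i].
edge-towards : ∀ {n} {u v : Word n} → IsPerm u → IsPerm v → ∀ a → Minimal u v a → u ≢ v →
               ∃ λ u′ → QBEdge u u′ × Minimal u′ v a × Φ a u′ ≡ suc (Φ a u)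
edge-towards {u = u} {v} u-perm v-perm a minimal u≢v with any? (λ p → ¬? (lookup u p ≟ lookup v p))
... | no same = contradiction (lookup-ext λ p → decidable-stable (lookup u p ≟ lookup v p) λ ne → same (p , ne)) u≢v
... | yes (p , differ) with least (λ p → ¬? (lookup u p ≟ lookup v p)) p differ
...   | i , ui≢vi , before with perm-surjective u u-perm (lookup v i)
...     | m , um≡vi with least (λ p → i F.<? p ×-dec arc? (toℕ (lookup u i)) (toℕ (lookup v i)) (toℕ (lookup u p))) m (i<m , m∈)
  where
  agree : ∀ p → p F.< i → lookup u p ≡ lookup v p
  agree p p<i = decidable-stable (lookup u p ≟ lookup v p) (before p p<i)
  i<m : i F.< m
  i<m with <-cmp (toℕ i) (toℕ m)
  ... | tri< i<m _ _ = i<m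
  ... | tri≈ _ i≡m _ = contradiction (trans (cong (lookup u) (toℕ-injective i≡m)) um≡vi) ui≢vi
  ... | tri> _ _ m<i = contradiction (v-perm m i (trans (sym (agree m m<i)) um≡vi)) (<⇒≢ᶠ m<i)
  m∈ : Arc (toℕ (lookup u i)) (toℕ (lookup v i)) (toℕ (lookup u m))
  m∈ rewrite um≡vi = arc-end (ui≢vi ∘ toℕ-injective)
...       | j , (i<j , j∈) , first = swapPos u i j , proj₁ D.step , D.minimal-swap , proj₂ D.step
  where
  module D = Descent {u = u} {v} u-perm {a} minimal i<j (λ p p<i → decidable-stable (lookup u p ≟ lookup v p) (before p p<i)) j∈
                     (λ p i<p p<j p∈ → first p p<j (i<p , p∈))

-- Distances

-- A crude bound. As every step raises `Φ a` by 1, it limits the number of steps and serves as fuel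
-- for the recursion below.
Φ-bound : ∀ {n} (a : Fin n → ℕ) → ∃ λ B → ∀ w → Φ a w ≤ B
Φ-bound {n} a = sum {n} (λ _ → sum {n} (λ _ → 1)) + 2 * sum {n} (λ _ → sum {n} (λ _ → 1)) , λ w → +-mono-≤
  (≤-trans (≤-reflexive (inv-sum w)) (sum-mono λ p → sum-mono λ q → when≤1 (p F.<? q) (ind≤1 (lookup w q F.<? lookup w p))))
  (*-monoʳ-≤ 2 (sum-mono λ k → sum-mono λ p → when≤1 (toℕ p <? suc (toℕ k)) (ind≤1 (toℕ (lookup w p) <? a k))))
  where
  when≤1 : ∀ {P : Set} (d : Dec P) {x} → x ≤ 1 → when d x ≤ 1
  when≤1 (yes _) x≤1 = x≤1
  when≤1 (no _)  _   = z≤n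

module _ {n} {v : Word n} (v-perm : IsPerm v) (a : Fin n → ℕ) where

  shortest-path : ∀ {u} → IsPerm u → Minimal u v a → ∃ λ d → QBPath u v d × d + Φ a u ≡ Φ a v
  shortest-path {u₀} u₀-perm = go (proj₁ (Φ-bound a)) u₀ u₀-perm (m≤m+n _ _)
    where
    go : ∀ fuel u → IsPerm u → proj₁ (Φ-bound a) ≤ fuel + Φ a u → Minimal u v a → ∃ λ d → QBPath u v d × d + Φ a u ≡ Φ a v
    go fuel u u-perm enough minimal with ≡-dec _≟_ u v
    ... | yes refl = 0 , here , refl
    ... | no u≢v with edge-towards u-perm v-perm a minimal u≢v
    -- Without fuel the bound is at most Φ(u), while a further step would give Φ(u) + 1 = Φ(u′),
    -- which is at most the bound.
    go zero u u-perm enough minimal | no u≢v | u′ , e , minimal′ , up =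
      contradiction (≤-trans (≤-reflexive (sym up)) (≤-trans (proj₂ (Φ-bound a) u′) enough)) (<⇒≱ (n<1+n _))
    go (suc fuel) u u-perm enough minimal | no u≢v | u′ , e , minimal′ , up
      with go fuel u′ (edge-perm u-perm e) (≤-trans enough (≤-reflexive (trans (sym (+-suc fuel (Φ a u))) (cong (fuel +_) (sym up))))) minimal′
    ... | d , path , length = suc d , there e path , trans (sym (+-suc d (Φ a u))) (trans (cong (d +_) (sym up)) length)

  dist-exists : ∀ {u} → IsPerm u → Minimal u v a → ∃ λ d → QBDist u v d × d + Φ a u ≡ Φ a v
  dist-exists {u} u-perm minimal with shortest-path u-perm minimal
  ... | d , path , length = d , (path , λ k path′ → +-cancelʳ-≤ (Φ a u) d k (≤-trans (≤-reflexive length) (path-Φ u-perm path′ a))) , length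

  dist-Φ : ∀ {u d} → IsPerm u → Minimal u v a → QBDist u v d → d + Φ a u ≡ Φ a v
  dist-Φ {u} {d} u-perm minimal (path , shortest) with shortest-path u-perm minimal
  ... | d₀ , path₀ , length = ≤-antisym (≤-trans (+-monoˡ-≤ (Φ a u) (shortest d₀ path₀)) (≤-reflexive length)) (path-Φ u-perm path a)

-- If the Lipschitz bound is attained at a, comparing with a altered in one coordinate gives minimality.
tight⇒minimal : ∀ {n} {x y : Word n} {d} {a} → (∀ b → Φ b y ≤ d + Φ b x) → Φ a y ≡ d + Φ a x → Minimal x y a
tight⇒minimal {n} {x} {y} {d} {a} lipschitz tight k s = *-cancelˡ-≤ 2 (
  combine (inv x) (inv y) d (prefixSum a x) (prefixSum a y) (prefixSum b x) (prefixSum b y)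
          (c x (a k)) (c y (a k)) (c x s) (c y s) (altered x) (altered y) (lipschitz b) (sym tight))
  where
  c : Word n → ℕ → ℕ
  c z r = count z (suc (toℕ k)) (below r)
  b : Fin n → ℕ
  b p = if does (p ≟ k) then s else a p
  b-k : b k ≡ s
  b-k with k ≟ k
  ... | yes _  = refl
  ... | no k≢k = contradiction refl k≢k
  b-≢ : ∀ p → p ≢ k → b p ≡ a p
  b-≢ p p≢k with p ≟ k
  ... | yes p≡k = contradiction p≡k p≢k
  ... | no _    = refl
  altered : ∀ z → prefixSum b z + c z (a k) ≡ prefixSum a z + c z s
  altered z = trans (sum-differ₁ k λ p p≢k → cong (λ r → count z (suc (toℕ p)) (below r)) (b-≢ p p≢k))
                    (cong (λ r → prefixSum a z + c z r) b-k)
  balance : ∀ ix iy d ax ay bx by xa ya xs ys →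
    2 * (xa + ys) + ((d + (ix + 2 * bx) + (iy + 2 * ay)) + (2 * (ax + xs) + 2 * (by + ya)))
    ≡ 2 * (xs + ya) + ((iy + 2 * by + (d + (ix + 2 * ax))) + (2 * (bx + xa) + 2 * (ay + ys)))
  balance = solve-∀
  combine : ∀ ix iy d ax ay bx by xa ya xs ys → bx + xa ≡ ax + xs → by + ya ≡ ay + ys →
            iy + 2 * by ≤ d + (ix + 2 * bx) → d + (ix + 2 * ax) ≡ iy + 2 * ay → 2 * (xa + ys) ≤ 2 * (xs + ya)
  combine ix iy d ax ay bx by xa ya xs ys h₁ h₂ h₃ h₄ =
    ≤-shift (+-mono-≤ (+-mono-≤ h₃ (≤-reflexive h₄)) (+-mono-≤ (≤-reflexive (cong (2 *_) h₁)) (≤-reflexive (cong (2 *_) (sym h₂)))))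
            (balance ix iy d ax ay bx by xa ya xs ys)

module _ {n} {u v w : Word n} (u-perm : IsPerm u) (v-perm : IsPerm v) (w-perm : IsPerm w) where

  -- All three distances are differences of `Φ a` for the same `a`, so they telescope.
  minimal⇒tilted : ∀ a → Minimal u w a → Minimal w v a → InTilted u v w
  minimal⇒tilted a uw wv with dist-exists w-perm a u-perm uw | dist-exists v-perm a w-perm wv
    | dist-exists v-perm a u-perm (Minimal-trans {u = u} {v} {w} {a} uw wv)
  ... | d₁ , D₁ , eq₁ | d₂ , D₂ , eq₂ | d , D , eq = d₁ , d₂ , d , D₁ , D₂ , D , +-cancelʳ-≡ (Φ a u) _ _ (begin
    d₁ + d₂ + Φ a u   ≡⟨ cong (_+ Φ a u) (+-comm d₁ d₂) ⟩
    d₂ + d₁ + Φ a u   ≡⟨ +-assoc d₂ d₁ (Φ a u) ⟩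
    d₂ + (d₁ + Φ a u) ≡⟨ cong (d₂ +_) eq₁ ⟩
    d₂ + Φ a w        ≡⟨ eq₂ ⟩
    Φ a v             ≡⟨ eq ⟨
    d + Φ a u         ∎)
    where open ≡-Reasoning

  -- The bounds for (u, w) and (w, v) add up to d₁ + d₂, which equals Φ_a(v) - Φ_a(u). Two upper
  -- bounds whose total is attained are each attained.
  tilted⇒minimal : ∀ a → InTilted u v w → Minimal u v a → Minimal u w a × Minimal w v a
  tilted⇒minimal a (d₁ , d₂ , d , (p₁ , _) , (p₂ , _) , D , refl) uv =
    tight⇒minimal {x = u} {w} {d₁} {a} (path-Φ u-perm p₁) (≤-antisym (path-Φ u-perm p₁ a) lower₁) ,
    tight⇒minimal {x = w} {v} {d₂} {a} (path-Φ w-perm p₂) (≤-antisym (path-Φ w-perm p₂ a) lower₂)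
    where
    total : d₂ + (d₁ + Φ a u) ≡ Φ a v
    total = trans (sym (+-assoc d₂ d₁ (Φ a u))) (trans (cong (_+ Φ a u) (+-comm d₂ d₁)) (dist-Φ v-perm a u-perm uv D))
    lower₁ : d₁ + Φ a u ≤ Φ a w
    lower₁ = +-cancelˡ-≤ d₂ _ _ (≤-trans (≤-reflexive total) (path-Φ w-perm p₂ a))
    lower₂ : d₂ + Φ a w ≤ Φ a v
    lower₂ = ≤-trans (+-monoʳ-≤ d₂ (path-Φ u-perm p₁ a)) (≤-reflexive total)

-- The orders ≤_r on prefixes as count inequalities

-- [r, s)_c is the initial segment of <_r formed by the elements before s; for s = r both are empty.
inCyc-downward : ∀ {n} {r s x y : Fin n} → x ≤[ r ] y → InCyc r s y → InCyc r s x
inCyc-downward (inj₁ (r≤x , _ , x≤y))         (inj₁ (r≤s , _ , y<s))      = inj₁ (r≤s , r≤x , ≤-<-trans x≤y y<s)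
inCyc-downward (inj₁ (r≤x , _ , _))           (inj₂ (s<r , _))            = inj₂ (s<r , inj₁ r≤x)
inCyc-downward (inj₂ (inj₁ (_ , y<r , _)))    (inj₁ (_ , r≤y , _))        = contradiction r≤y (<⇒≱ y<r)
inCyc-downward (inj₂ (inj₁ (_ , y<r , _)))    (inj₂ (_ , inj₁ r≤y))       = contradiction r≤y (<⇒≱ y<r)
inCyc-downward (inj₂ (inj₁ (_ , _ , x≤y)))    (inj₂ (s<r , inj₂ y<s))     = inj₂ (s<r , inj₂ (≤-<-trans x≤y y<s))
inCyc-downward (inj₂ (inj₂ (_ , y<r)))        (inj₁ (_ , r≤y , _))        = contradiction r≤y (<⇒≱ y<r)
inCyc-downward (inj₂ (inj₂ (r≤x , _)))        (inj₂ (s<r , _))            = inj₂ (s<r , inj₁ r≤x)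

-- With its converse `∉inCyc⇒≤`, this describes ≤_r through initial segments alone, so that counting
-- can replace comparing.
≤⇒∉inCyc : ∀ {n} {r x y : Fin n} → x ≤[ r ] y → ¬ InCyc r x y
≤⇒∉inCyc (inj₁ (_ , _ , x≤y))          (inj₁ (_ , _ , y<x))        = <⇒≱ y<x x≤y
≤⇒∉inCyc (inj₁ (r≤x , _ , _))          (inj₂ (x<r , _))            = <⇒≱ x<r r≤x
≤⇒∉inCyc (inj₂ (inj₁ (x<r , _ , _)))   (inj₁ (r≤x , _ , _))        = <⇒≱ x<r r≤x
≤⇒∉inCyc (inj₂ (inj₁ (_ , y<r , _)))   (inj₂ (_ , inj₁ r≤y))       = <⇒≱ y<r r≤y
≤⇒∉inCyc (inj₂ (inj₁ (_ , _ , x≤y)))   (inj₂ (_ , inj₂ y<x))       = <⇒≱ y<x x≤y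
≤⇒∉inCyc (inj₂ (inj₂ (_ , y<r)))       (inj₁ (_ , r≤y , _))        = <⇒≱ y<r r≤y
≤⇒∉inCyc (inj₂ (inj₂ (r≤x , _)))       (inj₂ (x<r , _))            = <⇒≱ x<r r≤x

∉inCyc⇒≤ : ∀ {n} {r x y : Fin n} → ¬ InCyc r x y → x ≤[ r ] y
∉inCyc⇒≤ {r = r} {x} {y} y∉ with <-≤-connex (toℕ x) (toℕ r) | <-≤-connex (toℕ y) (toℕ r)
... | inj₁ x<r | inj₁ y<r = inj₂ (inj₁ (x<r , y<r , ≮⇒≥ λ y<x → y∉ (inj₂ (x<r , inj₂ y<x))))
... | inj₁ x<r | inj₂ r≤y = contradiction (inj₂ (x<r , inj₁ r≤y)) y∉
... | inj₂ r≤x | inj₁ y<r = inj₂ (inj₂ (r≤x , y<r))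
... | inj₂ r≤x | inj₂ r≤y = inj₁ (r≤x , r≤y , ≮⇒≥ λ y<x → y∉ (inj₁ (r≤x , r≤y , y<x)))

≤[]-refl : ∀ {n} {r x : Fin n} → x ≤[ r ] x
≤[]-refl = ∉inCyc⇒≤ λ { (inj₁ (_ , _ , x<x)) → <-irrefl refl x<x
                      ; (inj₂ (x<r , inj₁ r≤x)) → <⇒≱ x<r r≤x
                      ; (inj₂ (_ , inj₂ x<x)) → <-irrefl refl x<x }

length-filter-∷ : ∀ {A : Set} {P : A → Set} (P? : Decidable P) x xs → length (filter P? (x ∷ xs)) ≡ ind (P? x) + length (filter P? xs)
length-filter-∷ P? x xs with does (P? x)
... | true  = refl
... | false = refl

module _ {n} (r : Fin n) where

  open DecMembership (_≟_ {n}) using (_∈?_)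

  private
    _≤ʳ_ : Fin n → Fin n → Set
    x ≤ʳ y = x ≤[ r ] y

  pointwise⇒countCyc : ∀ {xs ys} → Pointwise _≤ʳ_ xs ys → ∀ s → countCyc r s ys ≤ countCyc r s xs
  pointwise⇒countCyc [] s = z≤n
  pointwise⇒countCyc {x ∷ xs} {y ∷ ys} (x≤y ∷ rest) s = subst₂ _≤_ (sym (length-filter-∷ (inCyc? r s) y ys)) (sym (length-filter-∷ (inCyc? r s) x xs))
    (+-mono-≤ (ind-mono (inCyc? r s y) (inCyc? r s x) (inCyc-downward x≤y)) (pointwise⇒countCyc rest s))

  -- Induction along the sorted lists. The segment before `x` compares the heads: if it contained
  -- `y`, it would meet `y ∷ ys` but not `x ∷ xs`, all of whose entries are at least `x`.
  countCyc⇒pointwise : ∀ {xs ys} → AllPairs _≤ʳ_ xs → AllPairs _≤ʳ_ ys → length xs ≡ length ys →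
                       (∀ s → countCyc r s ys ≤ countCyc r s xs) → Pointwise _≤ʳ_ xs ys
  countCyc⇒pointwise [] [] _ _ = []
  countCyc⇒pointwise {x ∷ xs} {y ∷ ys} (x≤xs ∷ sorted-xs) (y≤ys ∷ sorted-ys) eq counts =
    head-≤ ∷ countCyc⇒pointwise sorted-xs sorted-ys (suc-injective eq) tail-counts
    where
    head-≤ : x ≤ʳ y
    head-≤ = ∉inCyc⇒≤ λ y∈ → <⇒≱ (filter-some (inCyc? r x) (here y∈)) (≤-trans (counts x)
      (≤-reflexive (cong length (filter-none (inCyc? r x) {x ∷ xs} (≤⇒∉inCyc ≤[]-refl ∷ All.map ≤⇒∉inCyc x≤xs)))))
    tail-counts : ∀ s → countCyc r s ys ≤ countCyc r s xs
    -- If `y` is outside the segment, so is every later entry of `ys` and the count is 0. If `y` is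
    -- inside, so is `x`, and both counts lose one.
    tail-counts s with inCyc? r s y
    ... | no y∉  = ≤-trans (≤-reflexive (cong length (filter-none (inCyc? r s) (All.map (λ y≤y′ y′∈ → y∉ (inCyc-downward y≤y′ y′∈)) y≤ys)))) z≤n
    ... | yes y∈ = s≤s⁻¹ (subst₂ _≤_ (cong length (filter-accept (inCyc? r s) y∈))
                                     (cong length (filter-accept (inCyc? r s) (inCyc-downward head-≤ y∈))) (counts s))

  private
    AllPairs-refine : ∀ {P : Fin n → Set} {R S : Fin n → Fin n → Set} → (∀ {x y} → P x → P y → R x y → S x y) →
                      ∀ {xs} → All P xs → AllPairs R xs → AllPairs S xs
    AllPairs-refine f []         []         = []
    AllPairs-refine f (px ∷ pxs) (rx ∷ rxs) = All.zipWith (λ (py , rxy) → f px py rxy) (pxs , rx) ∷ AllPairs-refine f pxs rxs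

    upper lower : List (Fin n)
    upper = filter (λ x → r F.≤? x) (allFin n)
    lower = filter (λ x → x F.<? r) (allFin n)

    all-upper : All (r F.≤_) upper
    all-upper = all-filter (λ x → r F.≤? x) (allFin n)

    all-lower : All (F._< r) lower
    all-lower = all-filter (λ x → x F.<? r) (allFin n)

  cycList-sorted : AllPairs _≤ʳ_ (cycList r)
  cycList-sorted = AllPairs.++⁺
    (AllPairs-refine (λ r≤x r≤y x<y → inj₁ (r≤x , r≤y , <⇒≤ x<y)) all-upper (AllPairs.filter⁺ (λ x → r F.≤? x) increasing))
    (AllPairs-refine (λ x<r y<r x<y → inj₂ (inj₁ (x<r , y<r , <⇒≤ x<y))) all-lower (AllPairs.filter⁺ (λ x → x F.<? r) increasing))
    (All.map (λ r≤x → All.map (λ y<r → inj₂ (inj₂ (r≤x , y<r))) all-lower) all-upper)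
    where
    increasing : AllPairs F._<_ (allFin n)
    increasing = AllPairs.tabulate⁺-< id

  cycList-unique : Unique (cycList r)
  cycList-unique = Unique.++⁺ (Unique.filter⁺ (λ x → r F.≤? x) (Unique.allFin⁺ n)) (Unique.filter⁺ (λ x → x F.<? r) (Unique.allFin⁺ n))
    λ (x∈upper , x∈lower) → <⇒≱ (All.lookup all-lower x∈lower) (All.lookup all-upper x∈upper)

  ∈-cycList : ∀ x → x ∈ cycList r
  ∈-cycList x with <-≤-connex (toℕ x) (toℕ r)
  ... | inj₁ x<r = ∈-++⁺ʳ upper (∈-filter⁺ (λ x → x F.<? r) (∈-allFin x) x<r)
  ... | inj₂ r≤x = ∈-++⁺ˡ (∈-filter⁺ (λ x → r F.≤? x) (∈-allFin x) r≤x)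

  sortedBy-sorted : ∀ A → AllPairs _≤ʳ_ (sortedBy r A)
  sortedBy-sorted A = AllPairs.filter⁺ (_∈? A) cycList-sorted

  -- Two duplicate-free lists with the same members are permutations of each other, so counts may be
  -- taken on the prefix itself rather than on its sorted form.
  sortedBy-↭ : ∀ {A} → Unique A → sortedBy r A ↭ A
  sortedBy-↭ {A} unique-A = ∼bag⇒↭ (unique∧set⇒bag (Unique.filter⁺ (_∈? A) cycList-unique) unique-A
    (mk⇔ (λ x∈ → proj₂ (∈-filter⁻ (_∈? A) {xs = cycList r} x∈)) (λ x∈A → ∈-filter⁺ (_∈? A) (∈-cycList _) x∈A)))

  countCyc-sortedBy : ∀ {A} → Unique A → ∀ s → countCyc r s (sortedBy r A) ≡ countCyc r s A
  countCyc-sortedBy unique-A s = ↭-length (filter-↭ (inCyc? r s) (sortedBy-↭ unique-A))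

  ⊑⇒countCyc : ∀ {A B} → Unique A → Unique B → A ⊑[ r ] B → ∀ s → countCyc r s B ≤ countCyc r s A
  ⊑⇒countCyc unique-A unique-B A⊑B s = subst₂ _≤_ (countCyc-sortedBy unique-B s) (countCyc-sortedBy unique-A s) (pointwise⇒countCyc A⊑B s)

  countCyc⇒⊑ : ∀ {A B} → Unique A → Unique B → length A ≡ length B → (∀ s → countCyc r s B ≤ countCyc r s A) → A ⊑[ r ] B
  countCyc⇒⊑ {A} {B} unique-A unique-B eq counts = countCyc⇒pointwise (sortedBy-sorted A) (sortedBy-sorted B)
    (trans (↭-length (sortedBy-↭ unique-A)) (trans eq (sym (↭-length (sortedBy-↭ unique-B)))))
    λ s → subst₂ _≤_ (sym (countCyc-sortedBy unique-B s)) (sym (countCyc-sortedBy unique-A s)) (counts s)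

-- Prefixes as duplicate-free lists, and their cyclic counts

toList-lookup : ∀ {A : Set} {n} (xs : Vec A n) → toList xs ≡ L.tabulate (lookup xs)
toList-lookup []       = refl
toList-lookup (x ∷ xs) = cong (x ∷_) (toList-lookup xs)

prefix-unique : ∀ {n} {w : Word n} → IsPerm w → ∀ k → Unique (prefix k w)
prefix-unique {w = w} w-perm k = Unique.take⁺ k (subst Unique (sym (toList-lookup w)) (Unique.tabulate⁺ (w-perm _ _)))

prefix-length : ∀ {n} (u v : Word n) k → length (prefix k u) ≡ length (prefix k v)
prefix-length u v k = trans (length-take k (toList u))
  (trans (cong (k ⊓_) (trans (length-toList u) (sym (length-toList v)))) (sym (length-take k (toList v))))

-- `cyc-count` summed over the prefix. The wrap-around term depends only on the length of the
-- prefix, so it cancels between two words.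
countCyc-below : ∀ {n} (w : Word n) k (r s : Fin n) →
  countCyc r s (prefix k w) + count w k (below (toℕ r)) ≡ count w k (below (toℕ s)) + count w k (λ _ → ind (s F.<? r))
countCyc-below w k r s = begin
  countCyc r s (prefix k w) + count w k (below (toℕ r))           ≡⟨ cong (_+ count w k (below (toℕ r))) (length-filter-take (inCyc? r s) w k) ⟩
  count w k (λ x → ind (inCyc? r s x)) + count w k (below (toℕ r)) ≡⟨ count-+ w k (λ x → ind (inCyc? r s x)) (below (toℕ r)) ⟨
  count w k (λ x → ind (inCyc? r s x) + below (toℕ r) x)          ≡⟨ count-cong w k (λ x → cyc-count (toℕ r) (toℕ s) (toℕ x)) ⟩
  count w k (λ x → below (toℕ s) x + ind (s F.<? r))              ≡⟨ count-+ w k (below (toℕ s)) (λ _ → ind (s F.<? r)) ⟩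
  count w k (below (toℕ s)) + count w k (λ _ → ind (s F.<? r))    ∎
  where open ≡-Reasoning

countCyc-≤⇔ : ∀ {n} (u v : Word n) k (r s : Fin n) → countCyc r s (prefix k v) ≤ countCyc r s (prefix k u) ⇔
  (count u k (below (toℕ r)) + count v k (below (toℕ s)) ≤ count u k (below (toℕ s)) + count v k (below (toℕ r)))
countCyc-≤⇔ u v k r s = mk⇔
  (λ h → to (countCyc r s (prefix k u)) (count u k (below (toℕ r))) (count u k (below (toℕ s)))
            (countCyc r s (prefix k v)) (count v k (below (toℕ r))) (count v k (below (toℕ s))) κ
            (countCyc-below u k r s) (countCyc-below v k r s) h)
  (λ h → from (countCyc r s (prefix k u)) (count u k (below (toℕ r))) (count u k (below (toℕ s)))
              (countCyc r s (prefix k v)) (count v k (below (toℕ r))) (count v k (below (toℕ s))) κ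
              (countCyc-below u k r s) (countCyc-below v k r s) h)
  where
  -- Counting a constant function never inspects the word, so by computation this is also the term
  -- for `v`.
  κ = count u k (λ _ → ind (s F.<? r))
  balance₁ : ∀ cu ur us cv vr vs κ → ur + vs + ((us + κ) + (cv + vr) + cu) ≡ us + vr + ((cu + ur) + (vs + κ) + cv)
  balance₁ = solve-∀
  balance₂ : ∀ cu ur us cv vr vs κ → cv + ((cu + ur) + (vs + κ) + (us + vr)) ≡ cu + ((us + κ) + (cv + vr) + (ur + vs))
  balance₂ = solve-∀
  to : ∀ cu ur us cv vr vs κ → cu + ur ≡ us + κ → cv + vr ≡ vs + κ → cv ≤ cu → ur + vs ≤ us + vr
  to cu ur us cv vr vs κ h₁ h₂ h = ≤-shift (+-mono-≤ (+-mono-≤ (≤-reflexive h₁) (≤-reflexive (sym h₂))) h) (balance₁ cu ur us cv vr vs κ)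
  from : ∀ cu ur us cv vr vs κ → cu + ur ≡ us + κ → cv + vr ≡ vs + κ → ur + vs ≤ us + vr → cv ≤ cu
  from cu ur us cv vr vs κ h₁ h₂ h = ≤-shift (+-mono-≤ (+-mono-≤ (≤-reflexive (sym h₁)) (≤-reflexive h₂)) h) (balance₂ cu ur us cv vr vs κ)

-- The difference of the two counts vanishes both at 0 and at every s ≥ n.
minimises-extend : ∀ {n} (u v : Word n) k r → 0 < n →
  (∀ s → s < n → count u k (below r) + count v k (below s) ≤ count u k (below s) + count v k (below r)) → Minimises u v k r
minimises-extend {n} u v k r 0<n h s with <-≤-connex s n
... | inj₁ s<n = h s s<n
... | inj₂ n≤s = begin
  count u k (below r) + count v k (below s) ≡⟨ cong (count u k (below r) +_) (full v) ⟩
  count u k (below r) + total               ≤⟨ +-monoˡ-≤ total at-0 ⟩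
  count v k (below r) + total               ≡⟨ +-comm (count v k (below r)) total ⟩
  total + count v k (below r)               ≡⟨ cong (_+ count v k (below r)) (full u) ⟨
  count u k (below s) + count v k (below r) ∎
  where
  open ≤-Reasoning
  total = count u k (λ _ → 1)
  full : ∀ w → count w k (below s) ≡ count w k (λ _ → 1)
  full w = count-cong w k λ x → when-yes (toℕ x <? s) (<-≤-trans (toℕ<n x) n≤s)
  empty : ∀ w → count w k (below 0) ≡ 0
  empty w = sum-≡0 {n} λ p → when-zero (toℕ p <? k)
    where
    when-zero : ∀ {P : Set} (d : Dec P) → when d 0 ≡ 0
    when-zero (yes _) = refl
    when-zero (no _)  = refl
  at-0 : count u k (below r) ≤ count v k (below r)
  at-0 = subst₂ _≤_ (trans (cong (count u k (below r) +_) (empty v)) (+-identityʳ _)) (cong (_+ count v k (below r)) (empty u)) (h 0 0<n)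

-- The order supplies thresholds in `Fin n` only, while the descent tests γ + 1, which may be n;
-- `minimises-extend` covers the remaining thresholds.
≤ₐ⇒minimal : ∀ {n} {u v : Word n} → IsPerm u → IsPerm v → ∀ a → u ≤ₐ[ a ] v → Minimal u v (toℕ ∘ lookup a)
≤ₐ⇒minimal {u = u} {v} u-perm v-perm a u≤v k = minimises-extend u v (suc (toℕ k)) (toℕ (lookup a k)) (≤-<-trans z≤n (toℕ<n k)) λ s s<n →
  subst (λ s → count u (suc (toℕ k)) (below (toℕ (lookup a k))) + count v (suc (toℕ k)) (below s)
               ≤ count u (suc (toℕ k)) (below s) + count v (suc (toℕ k)) (below (toℕ (lookup a k))))
        (toℕ-fromℕ< s<n)
        (Equivalence.to (countCyc-≤⇔ u v (suc (toℕ k)) (lookup a k) (fromℕ< s<n))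
          (⊑⇒countCyc (lookup a k) (prefix-unique u-perm (suc (toℕ k))) (prefix-unique v-perm (suc (toℕ k))) (u≤v k) (fromℕ< s<n)))

minimal⇒≤ₐ : ∀ {n} {u v : Word n} → IsPerm u → IsPerm v → ∀ a → Minimal u v (toℕ ∘ lookup a) → u ≤ₐ[ a ] v
minimal⇒≤ₐ {u = u} {v} u-perm v-perm a minimal k = countCyc⇒⊑ (lookup a k)
  (prefix-unique u-perm (suc (toℕ k))) (prefix-unique v-perm (suc (toℕ k))) (prefix-length u v (suc (toℕ k)))
  λ s → Equivalence.from (countCyc-≤⇔ u v (suc (toℕ k)) (lookup a k) s) (minimal k (toℕ s))

-- Common minimisers for consecutive prefixes

-- A minimiser of the integer-valued difference f - g on [0, n), with crossed terms in place of the
-- subtraction.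
argmin : ∀ n → 0 < n → (f g : ℕ → ℕ) → ∃ λ r → r < n × (∀ s → s < n → f r + g s ≤ f s + g r)
argmin (suc zero) _ f g = 0 , s≤s z≤n , λ { zero _ → ≤-refl ; (suc _) (s≤s ()) }
argmin (suc (suc m)) _ f g with argmin (suc m) (s≤s z≤n) f g
... | r , r<n , min with ≤-total (f r + g (suc m)) (f (suc m) + g r)
...   | inj₁ old = r , m<n⇒m<1+n r<n , bound
  where
  bound : ∀ s → s < suc (suc m) → f r + g s ≤ f s + g r
  bound s s<n with m≤n⇒m<n∨m≡n (s≤s⁻¹ s<n)
  ... | inj₁ s<1+m = min s s<1+m
  ... | inj₂ refl  = old
...   | inj₂ new = suc m , ≤-refl , bound
  where
  balance : ∀ ft gt fr gr fs gs → ft + gs + (fr + gt + (fs + gr)) ≡ fs + gt + (ft + gr + (fr + gs))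
  balance = solve-∀
  bound : ∀ s → s < suc (suc m) → f (suc m) + g s ≤ f s + g (suc m)
  bound s s<n with m≤n⇒m<n∨m≡n (s≤s⁻¹ s<n)
  ... | inj₁ s<1+m = ≤-shift (+-mono-≤ new (min s s<1+m)) (balance (f (suc m)) (g (suc m)) (f r) (g r) (f s) (g s))
  ... | inj₂ refl  = ≤-refl

-- Parity absorbs the extra 1 that `threshold-variation` leaves.
half-≤ : ∀ {x y} → 2 * x ≤ suc (2 * y) → x ≤ y
half-≤ {x} {y} h = ≮⇒≥ λ y<x → <⇒≱ (n<1+n (suc (2 * y))) (≤-trans (≤-reflexive (double-suc y)) (≤-trans (*-monoʳ-≤ 2 y<x) h))
  where
  double-suc : ∀ y → suc (suc (2 * y)) ≡ 2 * suc y
  double-suc = solve-∀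

-- The prefix functions of lengths k and k + 1 differ by a function with two consecutive values,
-- so a minimiser of their sum minimises both.
common-minimiser : ∀ {n} (u v : Word n) (k : Fin n) → ∃ λ (r : Fin n) → Minimises u v (toℕ k) (toℕ r) × Minimises u v (suc (toℕ k)) (toℕ r)
common-minimiser {n} u v k with argmin n (≤-<-trans z≤n (toℕ<n k))
  (λ r → count u (toℕ k) (below r) + count u (suc (toℕ k)) (below r)) (λ r → count v (toℕ k) (below r) + count v (suc (toℕ k)) (below r))
... | r , r<n , min = fromℕ< r<n ,
  subst (Minimises u v (toℕ k)) (sym (toℕ-fromℕ< r<n)) (minimises-extend u v (toℕ k) r 0<n λ s s<n →
    first (cu r) (cv r) (cu s) (cv s) (αᵤ r) (αᵥ r) (αᵤ s) (αᵥ s) (sum-min s s<n) (threshold-variation (toℕ (lookup u k)) (toℕ (lookup v k)) r s)) ,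
  subst (Minimises u v (suc (toℕ k))) (sym (toℕ-fromℕ< r<n)) (minimises-extend u v (suc (toℕ k)) r 0<n λ s s<n →
    subst₂ _≤_ (cong₂ _+_ (sym (count-suc u k (below r))) (sym (count-suc v k (below s)))) (cong₂ _+_ (sym (count-suc u k (below s))) (sym (count-suc v k (below r))))
    (second (cu r) (cv r) (cu s) (cv s) (αᵤ r) (αᵥ r) (αᵤ s) (αᵥ s) (sum-min s s<n) (threshold-variation (toℕ (lookup u k)) (toℕ (lookup v k)) s r)))
  where
  0<n = ≤-<-trans z≤n (toℕ<n k)
  cu cv αᵤ αᵥ : ℕ → ℕ
  cu x = count u (toℕ k) (below x)
  cv x = count v (toℕ k) (below x)
  αᵤ x = below x (lookup u k)
  αᵥ x = below x (lookup v k)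
  sum-min : ∀ s → s < n → (cu r + (cu r + αᵤ r)) + (cv s + (cv s + αᵥ s)) ≤ (cu s + (cu s + αᵤ s)) + (cv r + (cv r + αᵥ r))
  sum-min s s<n = subst₂ _≤_
    (cong₂ (λ x y → cu r + x + (cv s + y)) (count-suc u k (below r)) (count-suc v k (below s)))
    (cong₂ (λ x y → cu s + x + (cv r + y)) (count-suc u k (below s)) (count-suc v k (below r))) (min s s<n)
  balance₁ : ∀ ur vr us vs aur avr aus avs →
    2 * (ur + vs) + ((us + (us + aus)) + (vr + (vr + avr)) + suc (avs + aur)) ≡
    suc (2 * (us + vr)) + ((ur + (ur + aur)) + (vs + (vs + avs)) + (avr + aus))
  balance₁ = solve-∀
  -- Let g be the function for length k and d the step to length k + 1. Then 2g(r) + d(r) ≤ 2g(s) +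
  -- d(s) and d(s) ≤ d(r) + 1 give 2g(r) ≤ 2g(s) + 1.
  first : ∀ ur vr us vs aur avr aus avs → (ur + (ur + aur)) + (vs + (vs + avs)) ≤ (us + (us + aus)) + (vr + (vr + avr)) →
          avr + aus ≤ suc (avs + aur) → ur + vs ≤ us + vr
  first ur vr us vs aur avr aus avs h₁ h₂ = half-≤ (≤-shift (+-mono-≤ h₁ h₂) (balance₁ ur vr us vs aur avr aus avs))
  balance₂ : ∀ ur vr us vs aur avr aus avs →
    2 * ((ur + aur) + (vs + avs)) + ((us + (us + aus)) + (vr + (vr + avr)) + suc (avr + aus)) ≡
    suc (2 * ((us + aus) + (vr + avr))) + ((ur + (ur + aur)) + (vs + (vs + avs)) + (avs + aur))
  balance₂ = solve-∀
  -- For h = g + d the minimised sum is 2h - d, so the same argument uses d(r) ≤ d(s) + 1.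
  second : ∀ ur vr us vs aur avr aus avs → (ur + (ur + aur)) + (vs + (vs + avs)) ≤ (us + (us + aus)) + (vr + (vr + avr)) →
           avs + aur ≤ suc (avr + aus) → (ur + aur) + (vs + avs) ≤ (us + aus) + (vr + avr)
  second ur vr us vs aur avr aus avs h₁ h₂ = half-≤ (≤-shift (+-mono-≤ h₁ h₂) (balance₂ ur vr us vs aur avr aus avs))

-- u ∼_a v holds at k when a_k and a_{k+1} give the function for the prefixes of length k equal values.
Level : ∀ {n} → Word n → Word n → ℕ → ℕ → ℕ → Set
Level u v k r s = count u k (below r) + count v k (below s) ≡ count u k (below s) + count v k (below r)

countCyc-≡⇔ : ∀ {n} (u v : Word n) k (r s : Fin n) → countCyc r s (prefix k u) ≡ countCyc r s (prefix k v) ⇔ Level u v k (toℕ r) (toℕ s)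
countCyc-≡⇔ u v k r s = mk⇔
  (λ eq → ≤-antisym (Equivalence.to (countCyc-≤⇔ u v k r s) (≤-reflexive (sym eq)))
                    (subst₂ _≤_ (+-comm (count v k (below (toℕ r))) _) (+-comm (count v k (below (toℕ s))) _) (Equivalence.to (countCyc-≤⇔ v u k r s) (≤-reflexive eq))))
  (λ eq → ≤-antisym (Equivalence.from (countCyc-≤⇔ v u k r s) (≤-reflexive (flip eq))) (Equivalence.from (countCyc-≤⇔ u v k r s) (≤-reflexive eq)))
  where
  flip : Level u v k (toℕ r) (toℕ s) → Level v u k (toℕ r) (toℕ s)
  flip eq = trans (+-comm (count v k (below (toℕ r))) _) (trans (sym eq) (+-comm (count u k (below (toℕ r))) _))

-- The function for (u, v) is the sum of those for (u, w) and (w, v). Neither summand is smaller at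
-- s than at r, so equality of the sum forces equality of both.
level-split : ∀ {n} (u v w : Word n) k r s → Minimises u w k r → Minimises w v k r → Level u v k r s → Level u w k r s × Level w v k r s
level-split u v w k r s uw wv uv =
  split (c u r) (c u s) (c w r) (c w s) (c v r) (c v s) (uw s) (wv s) uv
  where
  c : Word _ → ℕ → ℕ
  c x t = count x k (below t)
  balance₁ : ∀ ur us wr ws vr vs → us + wr + (ws + vr + (ur + vs)) ≡ ur + ws + (wr + vs + (us + vr))
  balance₁ = solve-∀
  balance₂ : ∀ ur us wr ws vr vs → ws + vr + (us + wr + (ur + vs)) ≡ wr + vs + (ur + ws + (us + vr))
  balance₂ = solve-∀
  split : ∀ ur us wr ws vr vs → ur + ws ≤ us + wr → wr + vs ≤ ws + vr → ur + vs ≡ us + vr → ur + ws ≡ us + wr × wr + vs ≡ ws + vr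
  split ur us wr ws vr vs h₁ h₂ eq =
    ≤-antisym h₁ (≤-shift (+-mono-≤ h₂ (≤-reflexive (sym eq))) (balance₁ ur us wr ws vr vs)) ,
    ≤-antisym h₂ (≤-shift (+-mono-≤ h₁ (≤-reflexive (sym eq))) (balance₂ ur us wr ws vr vs))

minimal-at : ∀ {n} {u v : Word n} {a : Fin n → ℕ} → Minimal u v a → ∀ {k} (p : k < n) → Minimises u v (suc k) (a (fromℕ< p))
minimal-at {u = u} {v} {a} minimal p = subst (λ m → Minimises u v (suc m) (a (fromℕ< p))) (toℕ-fromℕ< p) (minimal (fromℕ< p))

≲ₐ-split : ∀ {n} {u v w : Word n} → IsPerm u → IsPerm v → IsPerm w → ∀ a → u ≲ₐ[ a ] v →
           Minimal u w (toℕ ∘ lookup a) → Minimal w v (toℕ ∘ lookup a) → (u ≲ₐ[ a ] w) × (w ≲ₐ[ a ] v)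
≲ₐ-split {n} {u} {v} {w} u-perm v-perm w-perm a (_ , u∼v) uw wv =
  (minimal⇒≤ₐ u-perm w-perm a uw , λ k p → Equivalence.from (countCyc-≡⇔ u w (suc k) (now k p) (next k p)) (proj₁ (levels k p))) ,
  (minimal⇒≤ₐ w-perm v-perm a wv , λ k p → Equivalence.from (countCyc-≡⇔ w v (suc k) (now k p) (next k p)) (proj₂ (levels k p)))
  where
  now next : ∀ k → suc k < n → Fin n
  now k p = lookup a (fromℕ< {k} (<-trans (n<1+n k) p))
  next k p = lookup a (fromℕ< p)
  levels : ∀ k p → Level u w (suc k) (toℕ (now k p)) (toℕ (next k p)) × Level w v (suc k) (toℕ (now k p)) (toℕ (next k p))
  levels k p = level-split u v w (suc k) (toℕ (now k p)) (toℕ (next k p))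
    (minimal-at {u = u} {w} {toℕ ∘ lookup a} uw (<-trans (n<1+n k) p)) (minimal-at {u = w} {v} {toℕ ∘ lookup a} wv (<-trans (n<1+n k) p))
    (Equivalence.to (countCyc-≡⇔ u v (suc k) (now k p) (next k p)) (u∼v k p))

-- Coordinate k, counted from 0, minimises the functions for lengths k and k + 1. Two consecutive
-- coordinates thus minimise the function of the length they share and give it the same value, which
-- is the ∼ condition.
≲ₐ-exists : ∀ {n} {u v : Word n} → IsPerm u → IsPerm v → Σ (Word n) λ a → u ≲ₐ[ a ] v
≲ₐ-exists {n} {u} {v} u-perm v-perm = a , minimal⇒≤ₐ u-perm v-perm a (proj₂ ∘ both) , λ k p →
  Equivalence.from (countCyc-≡⇔ u v (suc k) (lookup a (fromℕ< (<-trans (n<1+n k) p))) (lookup a (fromℕ< p)))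
    (≤-antisym (minimal-at {u = u} {v} {toℕ ∘ lookup a} (proj₂ ∘ both) (<-trans (n<1+n k) p) (toℕ (lookup a (fromℕ< p))))
               (subst (λ m → Minimises u v m (toℕ (lookup a (fromℕ< p)))) (toℕ-fromℕ< p) (proj₁ (both (fromℕ< p))) (toℕ (lookup a (fromℕ< (<-trans (n<1+n k) p))))))
  where
  a : Word n
  a = V.tabulate (proj₁ ∘ common-minimiser u v)
  both : ∀ k → Minimises u v (toℕ k) (toℕ (lookup a k)) × Minimises u v (suc (toℕ k)) (toℕ (lookup a k))
  both k = subst (λ r → Minimises u v (toℕ k) (toℕ r) × Minimises u v (suc (toℕ k)) (toℕ r))
                 (sym (lookup∘tabulate (proj₁ ∘ common-minimiser u v) k)) (proj₂ (common-minimiser u v k))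

-- The four equivalences

theorem3p13 : (n : ℕ) (u v w : Word n) → IsPerm u → IsPerm v → IsPerm w →
    (InTilted u v w ⇔ (∀ (a : Word n) → u ≤ₐ[ a ] v → (u ≤ₐ[ a ] w) × (w ≤ₐ[ a ] v)))
    × (InTilted u v w ⇔ Σ (Word n) (λ a → (u ≤ₐ[ a ] w) × (w ≤ₐ[ a ] v)))
    × (InTilted u v w ⇔ (∀ (a : Word n) → u ≲ₐ[ a ] v → (u ≲ₐ[ a ] w) × (w ≲ₐ[ a ] v)))
    × (InTilted u v w ⇔ Σ (Word n) (λ a → (u ≲ₐ[ a ] w) × (w ≲ₐ[ a ] v)))
theorem3p13 n u v w u-perm v-perm w-perm =
  mk⇔ 1⇒2 (λ h → 3⇒1 (a , h a u≤v)) ,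
  mk⇔ (λ t → a , 1⇒2 t a u≤v) 3⇒1 ,
  mk⇔ 1⇒4 (λ h → 5⇒1 (a , h a u≲v)) ,
  mk⇔ (λ t → a , 1⇒4 t a u≲v) 5⇒1
  where
  -- This single `a` is the witness for the existential conditions and the instance at which the
  -- universal ones are applied.
  a : Word n
  a = proj₁ (≲ₐ-exists {u = u} {v} u-perm v-perm)
  u≲v : u ≲ₐ[ a ] v
  u≲v = proj₂ (≲ₐ-exists {u = u} {v} u-perm v-perm)
  u≤v : u ≤ₐ[ a ] v
  u≤v = proj₁ u≲v

  minimals : InTilted u v w → ∀ a → u ≤ₐ[ a ] v → Minimal u w (toℕ ∘ lookup a) × Minimal w v (toℕ ∘ lookup a)
  minimals t a u≤v = tilted⇒minimal u-perm v-perm w-perm (toℕ ∘ lookup a) t (≤ₐ⇒minimal {u = u} {v} u-perm v-perm a u≤v)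

  1⇒2 : InTilted u v w → ∀ a → u ≤ₐ[ a ] v → (u ≤ₐ[ a ] w) × (w ≤ₐ[ a ] v)
  1⇒2 t a u≤v = minimal⇒≤ₐ {u = u} {w} u-perm w-perm a (proj₁ (minimals t a u≤v)) , minimal⇒≤ₐ {u = w} {v} w-perm v-perm a (proj₂ (minimals t a u≤v))

  1⇒4 : InTilted u v w → ∀ a → u ≲ₐ[ a ] v → (u ≲ₐ[ a ] w) × (w ≲ₐ[ a ] v)
  1⇒4 t a u≲v = ≲ₐ-split {u = u} {v} {w} u-perm v-perm w-perm a u≲v (proj₁ (minimals t a (proj₁ u≲v))) (proj₂ (minimals t a (proj₁ u≲v)))

  3⇒1 : Σ (Word n) (λ a → (u ≤ₐ[ a ] w) × (w ≤ₐ[ a ] v)) → InTilted u v w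
  3⇒1 (a , u≤w , w≤v) = minimal⇒tilted u-perm v-perm w-perm (toℕ ∘ lookup a) (≤ₐ⇒minimal {u = u} {w} u-perm w-perm a u≤w) (≤ₐ⇒minimal {u = w} {v} w-perm v-perm a w≤v)

  5⇒1 : Σ (Word n) (λ a → (u ≲ₐ[ a ] w) × (w ≲ₐ[ a ] v)) → InTilted u v w
  5⇒1 (a , u≲w , w≲v) = 3⇒1 (a , proj₁ u≲w , proj₁ w≲v)
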